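{- Let $m\ge 0$ be an integer, let $\lambda,\delta,\rho$ be three proper $m$-marked cycle shapes, and let $n\geq m$ be a natural number satisfying $n\geq |\lambda|$, $n\ge |\delta|$ and $n\ge|\rho|$. Then the structure coefficient $c_{\underline{\lambda}_n,\underline{\delta}_n}^{\underline{\rho}_n}(n)$ of the $m$-centraliser algebra $Z_{n,m}$ can be written as $$c_{\underline{\lambda}_n,\underline{\delta}_n}^{\underline{\rho}_n}(n)=\sum_{k=0}^{n-|\rho|}k_{\lambda\delta}^{\rho^k}\binom{n-|\rho|}{k},$$ where the $k_{\lambda\delta}^{\rho^k}$ (the structure coefficients of the algebra $\mathcal{A}^m_\infty$ of invariant formal combinations of $m$-partial permutations of $\mathbb{N}$) are integers independent of $n$.
   Context: Notation: $\mathbb{N}=\{1,2,3,\dots\}$, $[n]=\{1,\dots,n\}$, $[0]=\emptyset$; $\mathcal{S}_d$ is the group of permutations of a finite set $d$, and $\mathcal{S}_n=\mathcal{S}_{[n]}$. Products of permutations are compositions. For $0\le m\le n$, $Stab_n(m)$ is the subgroup of $\mathcal{S}_n$ of permutations fixing every element of $[m]$. Marked cycle shapes: let $\ast$ be a formal symbol. An $m$-marked cycle shape is a finite collection (multiset) of cycles (nonempty words up to cyclic rotation) with entries in $[m]\cup\{\ast\}$ such that each element of $[m]$ appears exactly once in total and $\ast$ appears $r$ times in total for some integer $r\ge 0$. Its size is $|\rho|=m+r$, and $m_1(\rho)$ is the number of cycles of $\rho$ equal to $(\ast)$ (cycles $(a)$ with $a\in[m]$ are not counted). $\rho$ is proper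 if $m_1(\rho)=0$. $\mathcal{P}^m$ is the set of all $m$-marked cycle shapes and $\mathcal{P}^m_n$ the set of those of size $n$. For $k\ge 0$, $\rho^k$ is the shape obtained from $\rho$ by adding $k$ cycles $(\ast)$; for $n\ge|\rho|$, $\underline{\rho}_n:=\rho^{\,n-|\rho|}\in\mathcal{P}^m_n$. If $d$ is a finite set with $[m]\subseteq d\subset\mathbb{N}$ and $\omega\in\mathcal{S}_d$, the $m$-marked cycle type of $\omega$ is the shape of size $|d|$ obtained from the full cycle notation of $\omega$ (fixed points included) by replacing each element of $d\setminus[m]$ by $\ast$. The $m$-centraliser algebra: $Z_{n,m}=\{z\in\mathbb{Z}[\mathcal{S}_n]: \tau z=z\tau \text{ for all }\tau\in Stab_n(m)\}$. For $\lambda\in\mathcal{P}^m_n$, let $K_\lambda$ be the sum of all permutations of $[n]$ with $m$-marked cycle type $\lambda$. The $K_\lambda$, $\lambda\in\mathcal{P}^m_n$, form a $\mathbb{Z}$-basis of $Z_{n,m}$, and the structure coefficients $c_{\lambda,\delta}^{\rho}(n)$ (for $\lambda,\delta,\rho\in\mathcal{P}^m_n$) are defined by $K_\lambda K_\delta=\sum_{\rho\in\mathcal{P}^m_n}c_{\lambda,\delta}^\rho(n)K_\rho$. The algebra $\mathcal{A}^m_\infty$: an $m$-partial permutation of $\mathbb{N}$ is a pair $(d,\omega)$ with $d$ a finite set, $[m]\subseteq d\subset\mathbb{N}$, and $\omega\in\mathcal{S}_d$. For such a pair, $\widetilde{\omega}$ is the permutation of $\mathbb{N}$ equal to $\omega$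 on $d$ and to the identity off $d$. The product is $(d_1,\omega_1)\cdot(d_2,\omega_2)=(d_1\cup d_2,(\widetilde{\omega}_1\circ\widetilde{\omega}_2)_{|d_1\cup d_2})$. Let $\mathcal{B}^m_\infty$ be the $\mathbb{C}$-algebra of all formal, possibly infinite, sums $\sum b_{d,\omega}(d,\omega)$ over $m$-partial permutations of $\mathbb{N}$ with $b_{d,\omega}\in\mathbb{C}$, with the product extended linearly (each $(d,\omega)$ has only finitely many factorizations). Let $Stab_{\mathbb{N}}(m)$ be the group of finitely supported permutations of $\mathbb{N}$ fixing each element of $[m]$, acting by $\sigma\cdot(d,\omega)=(\sigma(d),\sigma\circ\omega\circ\sigma^{ -1})$, and let $\mathcal{A}^m_\infty$ be the subalgebra of invariant elements of $\mathcal{B}^m_\infty$. For $\rho\in\mathcal{P}^m$, let ${\bf A}_\rho\in\mathcal{A}^m_\infty$ be the sum of all $m$-partial permutations $(d,\omega)$ of $\mathbb{N}$ with $m$-marked cycle type $\rho$. Every element of $\mathcal{A}^m_\infty$ is uniquely a (possibly infinite) linear combination of the ${\bf A}_\rho$, and the coefficients $k_{\lambda\delta}^\rho$ ($\lambda,\delta,\rho\in\mathcal{P}^m$) are defined by ${\bf A}_\lambda{\bf A}_\delta=\sum_{\rho\in\mathcal{P}^m}k_{\lambda\delta}^\rho{\bf A}_\rho$. -}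

module Defs where

open import Algebra.Bundles using (CommutativeRing)
import Algebra.Properties.Monoid.Mult as Mult
open import Data.Bool.Base using (if_then_else_)
open import Data.Fin.Base using (Fin; fromℕ<)
import Data.Fin.Properties as Fin
open import Data.Integer.Base using (ℤ; +_; -[1+_])
open import Data.Integer.Properties using (+-*-commutativeRing)
open import Data.List.Base
  using (List; []; _∷_; [_]; _++_; map; concat; concatMap; filter; foldr; length; replicate; upTo; take; drop)
open import Data.List.Extrema.Nat using (max; xs≤max)
open import Data.List.Membership.Propositional using (_∈_; _∉_; mapWith∈)
open import Data.List.Membership.Propositional.Properties using (∈-filter⁺; ∈-upTo⁺; ∈-++⁺ˡ; ∈-++⁺ʳ)
import Data.List.Membership.Setoid as SetoidMembership
open import Data.List.Membership.Setoid.Properties using (∈-∃++)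
open import Data.List.NonEmpty.Base as List⁺ using (List⁺; _∷_; toList)
import Data.List.Properties as List
import Data.List.Relation.Binary.Permutation.Setoid as Permutation
open import Data.List.Relation.Binary.Permutation.Setoid.Properties
  using (¬x∷xs↭[]; ∈-resp-↭; drop-∷; ↭-shift)
open import Data.List.Relation.Binary.Sublist.Propositional using (_⊆_; []; _∷_; _∷ʳ_)
open import Data.List.Relation.Binary.Sublist.Propositional.Properties using (All-resp-⊆)
open import Data.List.Relation.Unary.All as All using (All)
open import Data.List.Relation.Unary.AllPairs using (AllPairs; []; _∷_)
import Data.List.Relation.Unary.AllPairs.Properties as AllPairs
open import Data.List.Relation.Unary.Any as Any using (here; there)
import Data.List.Relation.Unary.Unique.Setoid as SetoidUnique
open import Data.Maybe.Base using (Maybe; just; nothing)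
open import Data.Maybe.Properties using (≡-dec)
open import Data.Nat.Base using (ℕ; zero; suc; _+_; _∸_; _≤_; _<_; s≤s)
open import Data.Nat.Properties using (_≟_; _≤?_; _<?_; m∸n+n≡m; m≤m+n; +-suc; anyUpTo?)
open import Data.List.Membership.DecPropositional _≟_ using (_∈?_)
open import Data.Product.Base using (Σ-syntax; ∃; ∃₂; _×_; _,_; proj₁)
open import Data.Sum.Base using (_⊎_; inj₁; inj₂)
open import Function.Base using (_∘_; id)
open import Function.Bundles using (_↔_; Inverse; mk↔ₛ′)
open import Function.Construct.Composition using (_↔-∘_)
open import Function.Construct.Identity using (↔-id)
open import Level using (Level; 0ℓ; _⊔_)
open import Relation.Binary.Bundles using (Setoid)
import Relation.Binary.Construct.On as On
open import Relation.Binary.Definitions using (Decidable)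
open import Relation.Binary.PropositionalEquality
  using (_≡_; refl; sym; trans; _≢_; cong; cong₂; subst)
open import Relation.Nullary using (Dec; yes; no; does)
open import Relation.Nullary.Decidable using (dec-true; dec-false; map′; _×-dec_)

private
  variable
    a r ℓ : Level

------------------------------------------------------------------------
-- Marked cycle shapes

-- The ground set is {0, 1, 2, …} rather than {1, 2, 3, …}, so that [n] is
-- {0, …, n-1}, i.e. Fin n, or upTo n as a list.
-- A letter is an element of [m] or the formal symbol ∗.

Letter : ℕ → Set
Letter m = Maybe (Fin m)

pattern ∗ = nothing

_≟ᴸ_ : ∀ {m} → Decidable {A = Letter m} _≡_
_≟ᴸ_ = ≡-dec Fin._≟_

occurrences : ∀ {m} → Letter m → List (Letter m) → ℕ
occurrences x = length ∘ filter (x ≟ᴸ_)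

Rotation : ∀ {A : Set} → List⁺ A → List⁺ A → Set
Rotation v w = ∃₂ λ xs ys → toList v ≡ xs ++ ys × toList w ≡ ys ++ xs

++-split : ∀ {A : Set} (us : List A) {vs} as {bs} → us ++ vs ≡ as ++ bs →
           (Σ[ w ∈ List A ] us ≡ as ++ w × bs ≡ w ++ vs) ⊎
           (Σ[ w ∈ List A ] as ≡ us ++ w × vs ≡ w ++ bs)
++-split []       as       eq = inj₂ (as , refl , eq)
++-split (u ∷ us) []       eq = inj₁ (u ∷ us , refl , sym eq)
++-split (u ∷ us) (x ∷ as) eq with List.∷-injective eq
... | refl , eq′ with ++-split us as eq′
...   | inj₁ (w , p , q) = inj₁ (w , cong (u ∷_) p , q)
...   | inj₂ (w , p , q) = inj₂ (w , cong (u ∷_) p , q)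

rotation-trans : ∀ {A : Set} {u v w : List⁺ A} → Rotation u v → Rotation v w → Rotation u w
rotation-trans (xs , ys , p , q) (xs′ , ys′ , p′ , q′) with ++-split ys xs′ (trans (sym q) p′)
... | inj₁ (w , refl , refl) =
  xs ++ xs′ , w , trans p (sym (List.++-assoc xs xs′ w)) , trans q′ (List.++-assoc w xs xs′)
... | inj₂ (w , refl , refl) =
  w , ys′ ++ ys , trans p (List.++-assoc w ys′ ys) , trans q′ (sym (List.++-assoc ys′ ys w))

rotationSetoid : Set → Setoid 0ℓ 0ℓ
rotationSetoid A = record
  { Carrier       = List⁺ A
  ; _≈_           = Rotation
  ; isEquivalence = record
    { refl  = λ {v} → [] , toList v , refl , sym (List.++-identityʳ (toList v))
    ; sym   = λ (xs , ys , p , q) → ys , xs , q , p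
    ; trans = rotation-trans
    }
  }

-- Multisets of cycles: lists of nonempty words, compared up to reordering the
-- list and rotating each word.

cyclesSetoid : Set → Setoid 0ℓ 0ℓ
cyclesSetoid A = Permutation.↭-setoid (rotationSetoid A)

record Shape (m : ℕ) : Set where
  field
    cycles   : List (List⁺ (Letter m))
    onceEach : ∀ (x : Fin m) → occurrences (just x) (concatMap toList cycles) ≡ 1

open Shape public

shapeSetoid : ℕ → Setoid 0ℓ 0ℓ
shapeSetoid m = On.setoid (cyclesSetoid (Letter m)) (cycles {m})

size : ∀ {m} → Shape m → ℕ
size {m} ρ = m + occurrences ∗ (concatMap toList (cycles ρ))

m₁ : ∀ {m} → Shape m → ℕ
m₁ ρ = length (filter (λ w → List.≡-dec _≟ᴸ_ (toList w) [ ∗ ]) (cycles ρ))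

Proper : ∀ {m} → Shape m → Set
Proper ρ = m₁ ρ ≡ 0

infixl 8 _^_

_^_ : ∀ {m} → Shape m → ℕ → Shape m
_^_ {m} ρ k = record
  { cycles   = replicate k (∗ ∷ []) ++ cycles ρ
  ; onceEach = λ x → trans (unchanged x k) (onceEach ρ x)
  }
  where
  unchanged : ∀ x k → occurrences (just x) (concatMap toList (replicate k (∗ ∷ []) ++ cycles ρ)) ≡
                      occurrences (just x) (concatMap toList (cycles ρ))
  unchanged x zero    = refl
  unchanged x (suc k) = unchanged x k

size-^ : ∀ {m} (ρ : Shape m) k → size (ρ ^ k) ≡ k + size ρ
size-^     ρ zero    = refl
size-^ {m} ρ (suc k) = trans (+-suc m _) (cong suc (size-^ ρ k))

ShapeOfSize : ℕ → ℕ → Set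
ShapeOfSize m n = Σ[ ρ ∈ Shape m ] size ρ ≡ n

shapeOfSizeSetoid : ℕ → ℕ → Setoid 0ℓ 0ℓ
shapeOfSizeSetoid m n = On.setoid (shapeSetoid m) (proj₁ {B = λ ρ → size ρ ≡ n})

-- The shape written ρ underlined with subscript n: ρ completed to size n by
-- cycles (∗).

complete : ∀ {m} (ρ : Shape m) n → size ρ ≤ n → ShapeOfSize m n
complete ρ n |ρ|≤n = ρ ^ (n ∸ size ρ) , trans (size-^ ρ (n ∸ size ρ)) (m∸n+n≡m |ρ|≤n)

------------------------------------------------------------------------
-- Decidability of equality of multisets of cycles

module _ {A : Set} (_≟ᴬ_ : Decidable {A = A} _≡_) where

  rotation? : Decidable (Rotation {A})
  rotation? v w = map′ to from
    (anyUpTo? (λ k → List.≡-dec _≟ᴬ_ (toList w) (drop k (toList v) ++ take k (toList v)))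
              (suc (length (toList v))))
    where
    to : (∃ λ k → k < suc (length (toList v)) × toList w ≡ drop k (toList v) ++ take k (toList v)) →
         Rotation v w
    to (k , _ , eq) = take k (toList v) , drop k (toList v) , sym (List.take++drop≡id k (toList v)) , eq

    drop-++ : ∀ (xs : List A) ys → drop (length xs) (xs ++ ys) ≡ ys
    drop-++ []       ys = refl
    drop-++ (x ∷ xs) ys = drop-++ xs ys

    take-++ : ∀ (xs : List A) ys → take (length xs) (xs ++ ys) ≡ xs
    take-++ []       ys = refl
    take-++ (x ∷ xs) ys = cong (x ∷_) (take-++ xs ys)

    from : Rotation v w →
           ∃ λ k → k < suc (length (toList v)) × toList w ≡ drop k (toList v) ++ take k (toList v)
    from (xs , ys , p , q) = length xs , s≤s |xs|≤|v| , trans q (sym eq)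
      where
      |xs|≤|v| : length xs ≤ length (toList v)
      |xs|≤|v| = subst (length xs ≤_) (sym (trans (cong length p) (List.length-++ xs)))
                       (m≤m+n (length xs) (length ys))

      eq : drop (length xs) (toList v) ++ take (length xs) (toList v) ≡ ys ++ xs
      eq = trans (cong (λ u → drop (length xs) u ++ take (length xs) u) p)
                 (cong₂ _++_ (drop-++ xs ys) (take-++ xs ys))

module _ {s₁ s₂} (S : Setoid s₁ s₂) (_≈?_ : Decidable (Setoid._≈_ S)) where
  open Setoid S using (_≈_) renaming (Carrier to C; sym to ≈-sym; refl to ≈-refl)
  open Permutation S using (_↭_; prep; ↭-sym; ↭-trans; ↭-refl; ↭-reflexive-≋)

  permutation? : Decidable _↭_
  permutation? []       []       = yes ↭-refl
  permutation? []       (y ∷ ys) = no (λ p → ¬x∷xs↭[] S (↭-sym p))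
  permutation? (x ∷ xs) ys with Any.any? (x ≈?_) ys
  ... | no  x∉ys = no (λ p → x∉ys (∈-resp-↭ S p (here ≈-refl)))
  ... | yes x∈ys with ∈-∃++ S x∈ys
  ...   | as , bs , w , x≈w , eq = map′
    (λ p → ↭-trans (prep x≈w p) (↭-sym ys↭w∷))
    (λ p → drop-∷ S (↭-trans p (↭-trans ys↭w∷ (prep (≈-sym x≈w) ↭-refl))))
    (permutation? xs (as ++ bs))
    where
    ys↭w∷ : ys ↭ w ∷ as ++ bs
    ys↭w∷ = ↭-trans (↭-reflexive-≋ eq) (↭-shift S as bs)

_≈ᶜ_ : ∀ {m} → List (List⁺ (Letter m)) → List (List⁺ (Letter m)) → Set
_≈ᶜ_ {m} = Setoid._≈_ (cyclesSetoid (Letter m))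

_≈ᶜ?_ : ∀ {m} → Decidable (_≈ᶜ_ {m})
_≈ᶜ?_ {m} = permutation? (rotationSetoid (Letter m)) (rotation? _≟ᴸ_)

------------------------------------------------------------------------
-- Permutations of finite sets of natural numbers

-- A permutation ω of a finite set d is given by its extension ω̃ to ℕ by the
-- identity.  Finite sets are lists without repetitions.

record Sym (d : List ℕ) : Set where
  field
    extension : ℕ ↔ ℕ
    fixesRest : ∀ {x} → x ∉ d → Inverse.to extension x ≡ x

open Sym public

infixl 9 _·_

_·_ : ∀ {d} → Sym d → ℕ → ℕ
ω · x = Inverse.to (extension ω) x

compose : ∀ {d₁ d₂ d} → (∀ {x} → x ∈ d₁ → x ∈ d) → (∀ {x} → x ∈ d₂ → x ∈ d) →
          Sym d₁ → Sym d₂ → Sym d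
compose d₁⊆d d₂⊆d ω₁ ω₂ = record
  { extension = extension ω₁ ↔-∘ extension ω₂
  ; fixesRest = λ x∉d → trans (cong (ω₁ ·_) (fixesRest ω₂ (x∉d ∘ d₂⊆d)))
                              (fixesRest ω₁ (x∉d ∘ d₁⊆d))
  }

_∘ₛ_ : ∀ {d} → Sym d → Sym d → Sym d
_∘ₛ_ = compose id id

transpose : ℕ → ℕ → ℕ → ℕ
transpose x y z = if does (z ≟ x) then y else if does (z ≟ y) then x else z

transpose-left : ∀ x y → transpose x y x ≡ y
transpose-left x y rewrite dec-true (x ≟ x) refl = refl

transpose-right : ∀ x y → transpose x y y ≡ x
transpose-right x y with y ≟ x
... | yes refl = transpose-left x x
... | no  y≢x  rewrite dec-false (y ≟ x) y≢x | dec-true (y ≟ y) refl = refl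

transpose-rest : ∀ {x y z} → z ≢ x → z ≢ y → transpose x y z ≡ z
transpose-rest {x} {y} {z} z≢x z≢y
  rewrite dec-false (z ≟ x) z≢x | dec-false (z ≟ y) z≢y = refl

transpose-involutive : ∀ x y z → transpose x y (transpose x y z) ≡ z
transpose-involutive x y z = helper (z ≟ x) (z ≟ y)
  where
  helper : Dec (z ≡ x) → Dec (z ≡ y) → transpose x y (transpose x y z) ≡ z
  helper (yes refl) _          = trans (cong (transpose x y) (transpose-left x y)) (transpose-right x y)
  helper (no _)     (yes refl) = trans (cong (transpose x y) (transpose-right x y)) (transpose-left x y)
  helper (no z≢x)   (no z≢y)   =
    trans (cong (transpose x y) (transpose-rest z≢x z≢y)) (transpose-rest z≢x z≢y)

transposition : ∀ {d x y} → x ∈ d → y ∈ d → Sym d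
transposition {x = x} {y} x∈d y∈d = record
  { extension = mk↔ₛ′ (transpose x y) (transpose x y)
                      (transpose-involutive x y) (transpose-involutive x y)
  ; fixesRest = λ z∉d → transpose-rest (λ { refl → z∉d x∈d }) (λ { refl → z∉d y∈d })
  }

-- All permutations of a set, each listed once: a permutation of {x} ∪ d sending
-- x to y is (x y) ∘ ω for a unique permutation ω of d.

permutations : (d : List ℕ) → List (Sym d)
permutations []      = [ record { extension = ↔-id ℕ ; fixesRest = λ _ → refl } ]
permutations (x ∷ d) = concat (mapWith∈ (x ∷ d) λ y∈ →
  map (compose id there (transposition (here refl) y∈)) (permutations d))

-- Cycle notation: the cycle of x is x, ω x, ω² x, … up to the first return to x
-- (a cycle meeting d has at most |d| entries), and each cycle of ω is written
-- once, starting from its least entry.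

orbit : ∀ {d} → Sym d → ℕ → List⁺ ℕ
orbit {d} ω x = x ∷ go (length d) (ω · x)
  where
  go : ℕ → ℕ → List ℕ
  go zero    _ = []
  go (suc l) y = if does (y ≟ x) then [] else y ∷ go l (ω · y)

cycleNotation : ∀ {d} → Sym d → List (List⁺ ℕ)
cycleNotation {d} ω = map (orbit ω) (filter (λ x → All.all? (x ≤?_) (toList (orbit ω x))) d)

mark : ∀ m → ℕ → Letter m
mark m x with x <? m
... | yes x<m = just (fromℕ< x<m)
... | no  _   = ∗

markedCycles : ∀ m {d} → Sym d → List (List⁺ (Letter m))
markedCycles m ω = map (List⁺.map (mark m)) (cycleNotation ω)

HasType : ∀ {m d} → Sym d → Shape m → Set
HasType {m} ω ρ = markedCycles m ω ≈ᶜ cycles ρ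

hasType? : ∀ {m d} (ω : Sym d) (ρ : Shape m) → Dec (HasType ω ρ)
hasType? {m} ω ρ = markedCycles m ω ≈ᶜ? cycles ρ

------------------------------------------------------------------------
-- Partial permutations

-- Finite subsets of ℕ are strictly increasing lists, so that equal sets are
-- equal lists.

record PartialPerm (m : ℕ) : Set where
  field
    domain     : List ℕ
    increasing : AllPairs _<_ domain
    marked     : All (_∈ domain) (upTo m)
    perm       : Sym domain

open PartialPerm public

_≈ₛ_ : ∀ {d d′} → Sym d → Sym d′ → Set
_≈ₛ_ {d} ω ω′ = All (λ x → ω · x ≡ ω′ · x) d

_≈ₛ?_ : ∀ {d d′} (ω : Sym d) (ω′ : Sym d′) → Dec (ω ≈ₛ ω′)
_≈ₛ?_ {d} ω ω′ = All.all? (λ x → ω · x ≟ ω′ · x) d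

_≈ₚ_ : ∀ {m} → PartialPerm m → PartialPerm m → Set
p ≈ₚ q = domain p ≡ domain q × perm p ≈ₛ perm q

_≈ₚ?_ : ∀ {m} → Decidable (_≈ₚ_ {m})
p ≈ₚ? q = List.≡-dec _≟_ (domain p) (domain q) ×-dec (perm p ≈ₛ? perm q)

infixr 6 _∪_

_∪_ : List ℕ → List ℕ → List ℕ
d ∪ e = filter (_∈? (d ++ e)) (upTo (suc (max 0 (d ++ e))))

∪-increasing : ∀ d e → AllPairs _<_ (d ∪ e)
∪-increasing d e = AllPairs.filter⁺ (_∈? (d ++ e)) (AllPairs.applyUpTo⁺₁ id (suc (max 0 (d ++ e))) (λ i<j _ → i<j))

∈-∪⁺ : ∀ {x} d e → x ∈ d ++ e → x ∈ d ∪ e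
∈-∪⁺ d e x∈ = ∈-filter⁺ (_∈? (d ++ e)) (∈-upTo⁺ (s≤s (All.lookup (xs≤max 0 (d ++ e)) x∈))) x∈

∈-∪⁺ˡ : ∀ {x} d e → x ∈ d → x ∈ d ∪ e
∈-∪⁺ˡ d e x∈d = ∈-∪⁺ d e (∈-++⁺ˡ x∈d)

∈-∪⁺ʳ : ∀ {x} d e → x ∈ e → x ∈ d ∪ e
∈-∪⁺ʳ d e x∈e = ∈-∪⁺ d e (∈-++⁺ʳ d x∈e)

_∙ₚ_ : ∀ {m} → PartialPerm m → PartialPerm m → PartialPerm m
p ∙ₚ q = record
  { domain     = domain p ∪ domain q
  ; increasing = ∪-increasing (domain p) (domain q)
  ; marked     = All.map (∈-∪⁺ˡ (domain p) (domain q)) (marked p)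
  ; perm       = compose (∈-∪⁺ˡ (domain p) (domain q)) (∈-∪⁺ʳ (domain p) (domain q)) (perm p) (perm q)
  }

subsets : (d : List ℕ) → AllPairs _<_ d → List (∃ λ e → e ⊆ d × AllPairs _<_ e)
subsets []      []          = [ [] , [] , [] ]
subsets (x ∷ d) (x<d ∷ d<) =
  map (λ (e , e⊆d , e<) → e , x ∷ʳ e⊆d , e<) (subsets d d<) ++
  map (λ (e , e⊆d , e<) → x ∷ e , refl ∷ e⊆d , All-resp-⊆ e⊆d x<d ∷ e<) (subsets d d<)

-- All partial permutations with domain contained in that of p; these include
-- every factor of p.

partialPermsWithin : ∀ {m} → PartialPerm m → List (PartialPerm m)
partialPermsWithin {m} p = concatMap on (subsets (domain p) (increasing p))
  where
  on : (∃ λ e → e ⊆ domain p × AllPairs _<_ e) → List (PartialPerm m)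
  on (e , _ , e<) with All.all? (_∈? e) (upTo m)
  ... | yes [m]⊆e = map (λ ω → record { increasing = e< ; marked = [m]⊆e ; perm = ω }) (permutations e)
  ... | no  _     = []

------------------------------------------------------------------------
-- Algebras of formal sums

-- A (possibly infinite) formal sum of elements of X with coefficients in R is
-- the function giving the coefficient of each element.  The coefficient ring is
-- arbitrary: ℤ for the group ring, and any commutative ring (such as ℂ) for
-- partial permutations.

module _ (R : CommutativeRing r ℓ) where
  open CommutativeRing R using (Carrier; _≈_; 0#; 1#; -_; +-monoid)
    renaming (_+_ to _⊕_; _*_ to _⊛_)

  FormalSum : Set a → Set _
  FormalSum X = X → Carrier

  fromℤ : ℤ → Carrier
  fromℤ (+ n)     = Mult._×_ +-monoid n 1#
  fromℤ (-[1+ n ]) = - Mult._×_ +-monoid (suc n) 1#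

  sumOver : ∀ {A : Set a} → List A → (A → Carrier) → Carrier
  sumOver xs f = foldr _⊕_ 0# (map f xs)

  -- Linear extension of a product on X: the coefficient of z is the sum over all
  -- factorizations z ≈ x ∙ y, where x and y range over the list factors z.

  convolution : {X : Set} {_≈ˣ_ : X → X → Set} (_∙_ : X → X → X) (_≈?_ : Decidable _≈ˣ_)
                (factors : X → List X) → FormalSum X → FormalSum X → FormalSum X
  convolution _∙_ _≈?_ factors f g z =
    sumOver (factors z) λ x → sumOver (factors z) λ y →
      if does ((x ∙ y) ≈? z) then f x ⊛ g y else 0#

  -- f IsSumOf g: f = Σ_i g i, where i ranges over the elements of I up to ≈ and
  -- each x has a nonzero coefficient in only finitely many of the g i.

  module _ (I : Setoid 0ℓ 0ℓ) where
    open Setoid I using () renaming (Carrier to Index; _≈_ to _≈ᴵ_)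
    open SetoidMembership I using () renaming (_∈_ to _∈ᴵ_)
    open SetoidUnique I using (Unique)

    _IsSumOf_ : {X : Set} → FormalSum X → (Index → FormalSum X) → Set _
    f IsSumOf g = ∀ x → Σ[ is ∈ List Index ]
      Unique is × (∀ i → i ∈ᴵ is ⊎ g i x ≈ 0#) × f x ≈ sumOver is (λ i → g i x)

    -- b i * b j = Σ_k c i j k · b k
    record StructureCoefficients {X : Set} (_*_ : FormalSum X → FormalSum X → FormalSum X)
                                 (b : Index → FormalSum X) : Set (r ⊔ ℓ) where
      field
        coeff      : Index → Index → Index → Carrier
        coeff-cong : ∀ {i i′ j j′ k k′} → i ≈ᴵ i′ → j ≈ᴵ j′ → k ≈ᴵ k′ → coeff i j k ≈ coeff i′ j′ k′
        expansion  : ∀ i j → (b i * b j) IsSumOf (λ k x → coeff i j k ⊛ b k x)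

open StructureCoefficients public

-- The group ring ℤ[S_n] with the elements K_λ, which form a basis of the
-- subring Z_{n,m}; products in Z_{n,m} are products in ℤ[S_n].

groupRingProduct : ∀ n → (f g : FormalSum +-*-commutativeRing (Sym (upTo n))) →
                   FormalSum +-*-commutativeRing (Sym (upTo n))
groupRingProduct n = convolution +-*-commutativeRing _∘ₛ_ _≈ₛ?_ (λ _ → permutations (upTo n))

K : ∀ {m n} → ShapeOfSize m n → FormalSum +-*-commutativeRing (Sym (upTo n))
K (ρ , _) ω = if does (hasType? ω ρ) then + 1 else + 0

CentraliserCoefficients : ℕ → ℕ → Set
CentraliserCoefficients n m =
  StructureCoefficients +-*-commutativeRing (shapeOfSizeSetoid m n) (groupRingProduct n) K

-- The algebra of all formal sums of m-partial permutations of ℕ with the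
-- elements A_ρ, whose linear combinations are exactly the elements of the
-- subalgebra of Stab_ℕ(m)-invariants.

module _ (R : CommutativeRing r ℓ) where
  open CommutativeRing R using (0#; 1#)

  partialPermProduct : ∀ m → (f g : FormalSum R (PartialPerm m)) → FormalSum R (PartialPerm m)
  partialPermProduct m = convolution R _∙ₚ_ _≈ₚ?_ partialPermsWithin

  A : ∀ {m} → Shape m → FormalSum R (PartialPerm m)
  A ρ p = if does (hasType? (perm p) ρ) then 1# else 0#

  PartialPermCoefficients : ℕ → Set _
  PartialPermCoefficients m = StructureCoefficients R (shapeSetoid m) (partialPermProduct m) A

{-# OPTIONS --safe #-}

-- A permutation σ of [n] of type λ completed by fixed points (∗), λ proper, is
-- the same as a partial permutation p of [n] of type λ: p and σ have the same
-- extension to ℕ, and the domain of p is [m] together with the points moved by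
-- σ.  Fix ω of type ρ completed to size n, with its |ρ| distinguished points
-- first.  Factorisations ω = σ τ then correspond to factorisations p q of the
-- partial permutations (upTo |ρ| ∪ S, ω), where S, the part of dom p ∪ dom q
-- outside upTo |ρ|, ranges over the subsets of the other n - |ρ| points.  By
-- conjugation invariance the number of the latter depends only on |S|, and for
-- |S| = k it is the coefficient of the shape ρ^k; there are n - |ρ| choose k
-- such sets.
module Submission where

open import Defs
open import Algebra.Bundles using (CommutativeRing)
open import Data.Bool.Base using (Bool; true; false; if_then_else_; _∧_)
open import Data.Fin.Base using (Fin; toℕ; fromℕ<)
import Data.Fin.Properties as Fin
open import Data.Integer.Base using (ℤ; +_; _*_)
open import Data.Integer.Properties using (+-*-commutativeRing)
import Data.Integer.Base as ℤ
import Data.Integer.Properties as ℤ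
open import Data.List.Base
  using (List; []; _∷_; [_]; _++_; map; concatMap; filter; foldr; length; replicate; applyUpTo; upTo; cartesianProduct)
open import Data.List.Membership.Propositional using (_∈_; _∉_; find; mapWith∈)
open import Data.List.Membership.Propositional.Properties
open import Data.List.NonEmpty.Base as List⁺ using (List⁺; _∷_; toList)
import Data.List.Properties as List
import Data.List.Relation.Binary.Permutation.Homogeneous as Perm
open import Data.List.Relation.Binary.Permutation.Propositional using (_↭_; ↭-refl; ↭-sym; ↭-trans; ↭-reflexive; ↭⇒↭ₛ)
open import Data.List.Relation.Binary.Permutation.Propositional.Properties
  using (++⁺; ++-comm; shifts; shift; ∈-resp-↭; ↭-length; filter-↭; ↭-singleton-inv)
import Data.List.Relation.Binary.Permutation.Setoid.Properties as ↭ₛ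
open import Data.List.Relation.Binary.Pointwise.Base using ([]; _∷_)
open import Data.List.Relation.Binary.Sublist.Propositional using (_⊆_; []; _∷_; _∷ʳ_; ⊆-antisym)
import Data.List.Relation.Binary.Sublist.Propositional as Sublist
open import Data.List.Relation.Binary.Sublist.Propositional.Properties using (All-resp-⊆)
open import Data.List.Relation.Unary.All as All using (All; []; _∷_)
import Data.List.Relation.Unary.All.Properties as All
open import Data.List.Relation.Unary.AllPairs as AllPairs using (AllPairs; []; _∷_)
import Data.List.Relation.Unary.AllPairs.Properties as AllPairs
open import Data.List.Relation.Unary.Any as Any using (here; there)
open import Data.List.Relation.Unary.Unique.Propositional using (Unique)
import Data.List.Relation.Unary.Unique.Propositional.Properties as Unique
import Data.List.Relation.Unary.Unique.Setoid.Properties as SetoidUnique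
open import Data.Maybe.Base using (just)
open import Data.Nat.Base using (ℕ; zero; suc; _+_; _∸_; _≤_; _<_; s≤s; z≤n)
import Data.Nat.Base as ℕ
open import Data.Nat.Combinatorics using (_C_)
import Data.Nat.Combinatorics as Comb
open import Data.Nat.ListAction using (sum)
open import Data.Nat.ListAction.Properties using (sum-++)
open import Data.Nat.Properties as ℕ using (_≟_; _≤?_; _<?_)
open import Data.List.Membership.DecPropositional _≟_ using (_∈?_)
open import Data.Product.Base using (Σ-syntax; ∃; ∃₂; _×_; _,_; proj₁; proj₂)
open import Data.Sum.Base using (_⊎_; inj₁; inj₂; [_,_]′)
open import Function.Base using (_∘_; id)
open import Function.Bundles using (_↔_; Inverse)
open import Function.Construct.Composition using (_↔-∘_)
open import Function.Construct.Identity using (↔-id)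
open import Function.Construct.Symmetry using (↔-sym)
open import Level using (0ℓ)
open import Relation.Binary.Bundles using (Setoid)
open import Relation.Binary.PropositionalEquality
  using (_≡_; refl; sym; trans; _≢_; cong; cong₂; subst; setoid; module ≡-Reasoning)
open import Relation.Nullary using (¬_; Dec; yes; no; does; contradiction)
open import Relation.Nullary.Decidable using (dec-true; dec-false; _×-dec_; _⊎-dec_; ¬?)

-- Structure coefficients are given only through the expansions that they satisfy, so each is read
-- off by evaluating a product at one element of the required type; this is why a permutation of
-- every shape has to be constructed. The basis elements are indicator functions, so the evaluated
-- product counts factorisations. Both families of coefficients thus come from natural numbers, and
-- over an arbitrary commutative ring the coefficient is the image of such a number. Properness
-- enters twice. For λ and δ it makes the domain of a factor recoverable from its extension. For ρ
-- it makes ω move each of the first |ρ| points outside [m]; then `σ` or `τ` moves it too, so dom p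
-- ∪ dom q contains all of `upTo |ρ|` and only the part S is free. The obstacle is equality:
-- permutations carry functions and proofs, so lists of them are irredundant only up to pointwise
-- equality. Bijections therefore appear as pairs of inequalities obtained from relations. For the
-- same reason cycle types are not compared through the canonical notation: any cycle decomposition
-- determines the type, up to order and rotation.

-- Paths and cycles of a self-map of ℕ

-- Path f x us y: us lists x, f x, f² x, … up to but excluding y.
data Path (f : ℕ → ℕ) : ℕ → List ℕ → ℕ → Set where
  []   : ∀ {x} → Path f x [] x
  step : ∀ {x us y} → Path f (f x) us y → Path f x (x ∷ us) y

Path-++⁺ : ∀ {f x us y vs z} → Path f x us y → Path f y vs z → Path f x (us ++ vs) z
Path-++⁺ []       q = q
Path-++⁺ (step p) q = step (Path-++⁺ p q)

Path-++⁻ : ∀ {f x z} us {vs} → Path f x (us ++ vs) z → ∃ λ y → Path f x us y × Path f y vs z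
Path-++⁻ []       q        = _ , [] , q
Path-++⁻ (_ ∷ us) (step p) with y , p₁ , p₂ ← Path-++⁻ us p = y , step p₁ , p₂

-- Both lists follow the same iterates and stop at the first arrival at y, so neither can continue
-- past the end of the other.
Path-functional : ∀ {f x us vs y} → Path f x us y → Path f x vs y → y ∉ us → y ∉ vs → us ≡ vs
Path-functional []       []       _    _    = refl
Path-functional []       (step q) _    y∉vs = contradiction (here refl) y∉vs
Path-functional (step p) []       y∉us _    = contradiction (here refl) y∉us
Path-functional (step p) (step q) y∉us y∉vs = cong (_ ∷_) (Path-functional p q (y∉us ∘ there) (y∉vs ∘ there))

-- A word that runs round a cycle several times also qualifies; distinctness of the entries is
-- imposed separately where it matters.
IsCycle : (ℕ → ℕ) → List⁺ ℕ → Set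
IsCycle f w = ∃ λ x → Path f x (toList w) x

IsCycle-rotate : ∀ {f v w} → Rotation v w → IsCycle f v → IsCycle f w
IsCycle-rotate {f} (xs , ys , v≡ , w≡) (x , p)
  with y , p₁ , p₂ ← Path-++⁻ xs (subst (λ u → Path f x u x) v≡ p)
  = y , subst (λ u → Path f y u y) (sym w≡) (Path-++⁺ p₂ p₁)

Rotation⇒↭ : ∀ {X : Set} {v w : List⁺ X} → Rotation v w → toList v ↭ toList w
Rotation⇒↭ (xs , ys , v≡ , w≡) =
  ↭-trans (↭-reflexive v≡) (↭-trans (++-comm xs ys) (↭-reflexive (sym w≡)))

Unique-resp-↭ : ∀ {X : Set} {xs ys : List X} → xs ↭ ys → Unique xs → Unique ys
Unique-resp-↭ p = ↭ₛ.Unique-resp-↭ (setoid _) (↭⇒↭ₛ p)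

Unique-++⁻ʳ : ∀ {X : Set} (xs : List X) {ys} → Unique (xs ++ ys) → Unique ys
Unique-++⁻ʳ []       u       = u
Unique-++⁻ʳ (_ ∷ xs) (_ ∷ u) = Unique-++⁻ʳ xs u

Unique-++⁻ˡ : ∀ {X : Set} (xs : List X) {ys} → Unique (xs ++ ys) → Unique xs
Unique-++⁻ˡ []       u        = []
Unique-++⁻ˡ (_ ∷ xs) (x∉ ∷ u) = All.++⁻ˡ xs x∉ ∷ Unique-++⁻ˡ xs u

Unique-++⇒disjoint : ∀ {X : Set} (xs : List X) {ys} → Unique (xs ++ ys) → ∀ {x} → x ∈ xs → x ∉ ys
Unique-++⇒disjoint (_ ∷ xs) (x∉ ∷ u) (here refl)  x∈ys = All.lookup x∉ (∈-++⁺ʳ xs x∈ys) refl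
Unique-++⇒disjoint (_ ∷ xs) (x∉ ∷ u) (there x∈xs) x∈ys = Unique-++⇒disjoint xs u x∈xs x∈ys

module _ {X : Set} where
  open Setoid (rotationSetoid X) public using ()
    renaming (refl to rotation-refl; sym to rotation-sym)

rotateTo : ∀ {X : Set} {x : X} {w} → x ∈ toList w → ∃ λ xs → Rotation w (x ∷ xs)
rotateTo x∈w with as , bs , w≡ ← ∈-∃++ x∈w = bs ++ as , as , _ , w≡ , refl

-- After rotation both words start at x, and with distinct entries each ends at the first return to
-- x, so `Path-functional` identifies them.
cycles-through : ∀ {f v w x} → IsCycle f v → IsCycle f w → Unique (toList v) → Unique (toList w) →
                 x ∈ toList v → x ∈ toList w → Rotation v w
cycles-through {f} {v} {w} {x} cv cw uv uw x∈v x∈w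
  with xs , rv ← rotateTo {w = v} x∈v | ys , rw ← rotateTo {w = w} x∈w
  with x , step p ← IsCycle-rotate rv cv | .x , step q ← IsCycle-rotate rw cw
  = rotation-trans (subst (λ u → Rotation v (x ∷ u)) xs≡ys rv) (rotation-sym rw)
  where
  xs≡ys : xs ≡ ys
  xs≡ys = Path-functional p q (Unique.Unique[x∷xs]⇒x∉xs (Unique-resp-↭ (Rotation⇒↭ rv) uv))
                              (Unique.Unique[x∷xs]⇒x∉xs (Unique-resp-↭ (Rotation⇒↭ rw) uw))

-- Cycle decompositions

infix 4 _↭ᶜ_

_↭ᶜ_ : ∀ {X : Set} → List (List⁺ X) → List (List⁺ X) → Set
_↭ᶜ_ {X} = Setoid._≈_ (cyclesSetoid X)

module _ {X : Set} where
  open Setoid (cyclesSetoid X) public using ()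
    renaming (refl to ↭ᶜ-refl; sym to ↭ᶜ-sym; trans to ↭ᶜ-trans; reflexive to ↭ᶜ-reflexive)

entries-↭ : ∀ {X : Set} {cs cs′ : List (List⁺ X)} → cs ↭ᶜ cs′ →
            concatMap toList cs ↭ concatMap toList cs′
entries-↭ (Perm.refl [])               = ↭-refl
entries-↭ (Perm.refl (r ∷ rs))         = ++⁺ (Rotation⇒↭ r) (entries-↭ (Perm.refl rs))
entries-↭ (Perm.prep r p)              = ++⁺ (Rotation⇒↭ r) (entries-↭ p)
entries-↭ (Perm.swap {x = v} {w} r s p) =
  ↭-trans (shifts (toList v) (toList w)) (++⁺ (Rotation⇒↭ s) (++⁺ (Rotation⇒↭ r) (entries-↭ p)))
entries-↭ (Perm.trans p q)             = ↭-trans (entries-↭ p) (entries-↭ q)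

-- The ground set is a predicate, so that splitting off one cycle merely adds a condition to it and
-- inductions on the list of cycles go through.
record CycleDecomposition (f : ℕ → ℕ) (D : ℕ → Set) (cs : List (List⁺ ℕ)) : Set where
  field
    cyclic : All (IsCycle f) cs
    unique : Unique (concatMap toList cs)
    sound  : ∀ {x} → x ∈ concatMap toList cs → D x
    covers : ∀ {x} → D x → x ∈ concatMap toList cs

open CycleDecomposition public

decomposition-resp : ∀ {f D cs cs′} → cs ↭ᶜ cs′ → CycleDecomposition f D cs → CycleDecomposition f D cs′
decomposition-resp p c = record
  { cyclic = ↭ₛ.All-resp-↭ (rotationSetoid ℕ) IsCycle-rotate p (cyclic c)
  ; unique = Unique-resp-↭ (entries-↭ p) (unique c)
  ; sound  = λ x∈ → sound c (∈-resp-↭ (↭-sym (entries-↭ p)) x∈)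
  ; covers = λ d → ∈-resp-↭ (entries-↭ p) (covers c d)
  }

decomposition-tail : ∀ {f D w cs} → CycleDecomposition f D (w ∷ cs) →
                     CycleDecomposition f (λ x → D x × x ∉ toList w) cs
decomposition-tail {w = w} c = record
  { cyclic = All.tail (cyclic c)
  ; unique = Unique-++⁻ʳ (toList w) (unique c)
  ; sound  = λ x∈ → sound c (∈-++⁺ʳ (toList w) x∈) ,
                    λ x∈w → Unique-++⇒disjoint (toList w) (unique c) x∈w x∈
  ; covers = λ (d , x∉w) → [ (λ x∈w → contradiction x∈w x∉w) , id ]′ (∈-++⁻ (toList w) (covers c d))
  }

-- The first entry of the first cycle of `cs` lies in some cycle of `cs′`. The two cycles are
-- rotations of each other; once the second is moved to the front, both tails decompose the same
-- remaining set.
decomposition-unique : ∀ {f D cs cs′} → CycleDecomposition f D cs → CycleDecomposition f D cs′ → cs ↭ᶜ cs′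
decomposition-unique {cs = []} {[]}     c c′ = ↭ᶜ-refl
decomposition-unique {cs = []} {w ∷ cs′} c c′ with () ← covers c (sound c′ (here refl))
decomposition-unique {f} {cs = w ∷ cs} {cs′} c c′
  with w′ , w′∈ , x∈w′ ← find (∈-concatMap⁻ toList {xs = cs′} (covers c′ (sound c (here refl))))
  with as , bs , refl ← ∈-∃++ w′∈
  = ↭ᶜ-trans (Perm.prep rotation-refl (decomposition-unique (decomposition-tail c)
                (decomposition-tail (decomposition-resp moved c′)))) (↭ᶜ-sym moved)
  where
  moveFront : as ++ w′ ∷ bs ↭ᶜ w′ ∷ as ++ bs
  moveFront = ↭ₛ.↭-shift (rotationSetoid ℕ) as bs

  moved : as ++ w′ ∷ bs ↭ᶜ w ∷ as ++ bs
  moved = ↭ᶜ-trans moveFront (Perm.prep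
    (cycles-through (All.lookup (cyclic c′) w′∈) (All.head (cyclic c))
      (Unique-++⁻ˡ (toList w′) (unique (decomposition-resp moveFront c′)))
      (Unique-++⁻ˡ (toList w) (unique c)) x∈w′ (here refl))
    ↭ᶜ-refl)

-- The cycle notation is a cycle decomposition

-- The injection principle for lists up to an equivalence. The correspondence may be any relation,
-- provided that elements sharing a partner are equivalent; a partner, once used, is deleted from
-- `ys`, and the elements left over do not need it.
count-≤ : ∀ {x y} {X : Set x} {Y : Set y} {_≈_ : X → X → Set} (_~_ : X → Y → Set) →
          (∀ {x x′ y} → x ~ y → x′ ~ y → x ≈ x′) → ∀ {xs ys} → AllPairs (λ x x′ → ¬ x ≈ x′) xs →
          (∀ {x} → x ∈ xs → ∃ λ y → y ∈ ys × x ~ y) → length xs ≤ length ys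
count-≤ _~_ inj {[]}     []       _ = z≤n
count-≤ {Y = Y} _~_ inj {x ∷ xs} (x≉ ∷ u) f
  with y , y∈ , x~y ← f (here refl)
  with as , bs , refl ← ∈-∃++ y∈
  = subst (suc (length xs) ≤_) (sym (↭-length (shift y as bs))) (s≤s (count-≤ _~_ inj u f′))
  where
  avoid : ∀ {x′ y′} → x′ ∈ xs → x′ ~ y′ → y′ ∈ as ⊎ y′ ∈ y ∷ bs → y′ ∈ as ++ bs
  avoid x′∈ x′~y′ (inj₁ y′∈as)         = ∈-++⁺ˡ y′∈as
  avoid x′∈ x′~y′ (inj₂ (here refl))   = contradiction (inj x~y x′~y′) (All.lookup x≉ x′∈)
  avoid x′∈ x′~y′ (inj₂ (there y′∈bs)) = ∈-++⁺ʳ as y′∈bs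

  f′ : ∀ {x′} → x′ ∈ xs → ∃ λ y′ → y′ ∈ as ++ bs × x′ ~ y′
  f′ x′∈ with y′ , y′∈ , x′~y′ ← f (there x′∈) = y′ , avoid x′∈ x′~y′ (∈-++⁻ as y′∈) , x′~y′

Unique-⊆-length : ∀ {xs ys : List ℕ} → Unique xs → (∀ {x} → x ∈ xs → x ∈ ys) → length xs ≤ length ys
Unique-⊆-length u xs⊆ys = count-≤ _≡_ (λ x≡y x′≡y → trans x≡y (sym x′≡y)) u (λ x∈ → _ , xs⊆ys x∈ , refl)

↔-injective : ∀ (e : ℕ ↔ ℕ) {x y} → Inverse.to e x ≡ Inverse.to e y → x ≡ y
↔-injective e {x} {y} eq = trans (sym (Inverse.strictlyInverseʳ e x))
  (trans (cong (Inverse.from e) eq) (Inverse.strictlyInverseʳ e y))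

·-injective : ∀ {d} (ω : Sym d) {x y} → ω · x ≡ ω · y → x ≡ y
·-injective ω = ↔-injective (extension ω)

-- If `ω · x` were outside d it would be fixed, and injectivity would give `ω · x ≡ x`, a point of
-- d.
·-closed : ∀ {d} (ω : Sym d) {x} → x ∈ d → ω · x ∈ d
·-closed {d} ω {x} x∈ with (ω · x) ∈? d
... | yes ωx∈ = ωx∈
... | no  ωx∉ = subst (_∈ d) (sym (·-injective ω (fixesRest ω ωx∉))) x∈

walk : (ℕ → ℕ) → ℕ → ℕ → ℕ → List ℕ
walk f x zero    y = []
walk f x (suc l) y = if does (y ≟ x) then [] else y ∷ walk f x l (f y)

-- The metavariable stands for the local function of orbit, which has no name
-- outside its definition.
orbit-go≡walk : ∀ {d} (ω : Sym d) x l y → _ ≡ walk (ω ·_) x l y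

orbit≡walk : ∀ {d} (ω : Sym d) x → orbit ω x ≡ x ∷ walk (ω ·_) x (length d) (ω · x)
orbit≡walk {d} ω x with length d | ω · x
... | l | y = cong (x ∷_) (orbit-go≡walk ω x l y)

orbit-go≡walk ω x zero    y = refl
orbit-go≡walk ω x (suc l) y = cong (λ us → if does (y ≟ x) then [] else y ∷ us) (orbit-go≡walk ω x l (ω · y))

walk-stop : ∀ f x l → walk f x (suc l) x ≡ []
walk-stop f x l rewrite dec-true (x ≟ x) refl = refl

walk-go : ∀ f {x} l {y} → y ≢ x → walk f x (suc l) y ≡ y ∷ walk f x l (f y)
walk-go f {x} l {y} y≢x rewrite dec-false (y ≟ x) y≢x = refl

start∉walk : ∀ f x l y → x ∉ walk f x l y
start∉walk f x (suc l) y x∈ with y ≟ x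
... | yes refl with () ← subst (x ∈_) (walk-stop f x l) x∈
... | no  y≢x  with subst (x ∈_) (walk-go f l y≢x) x∈
...   | here x≡y  = y≢x (sym x≡y)
...   | there x∈′ = start∉walk f x l (f y) x∈′

-- The alternative records why the walk ended: it came back to x, or the step bound l was exhausted.
-- Counting points of d later excludes the second case for orbits.
walk-path : ∀ f x l y → ∃ λ z → Path f y (walk f x l y) z × (z ≡ x ⊎ length (walk f x l y) ≡ l)
walk-path f x zero    y = y , [] , inj₂ refl
walk-path f x (suc l) y = helper (y ≟ x)
  where
  helper : Dec (y ≡ x) →
           ∃ λ z → Path f y (walk f x (suc l) y) z × (z ≡ x ⊎ length (walk f x (suc l) y) ≡ suc l)
  helper (yes refl) rewrite walk-stop f x l = x , [] , inj₁ refl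
  helper (no y≢x) rewrite walk-go f l y≢x with walk-path f x l (f y)
  ... | z , p , inj₁ z≡x   = z , step p , inj₁ z≡x
  ... | z , p , inj₂ |w|≡l = z , step p , inj₂ (cong suc |w|≡l)

Path-predecessor : ∀ {f x us z y} → Path f (f x) us z → y ∈ us → ∃ λ w → w ∈ x ∷ us × y ≡ f w
Path-predecessor (step p) (here refl) = _ , here refl , refl
Path-predecessor (step p) (there y∈) with w , w∈ , y≡ ← Path-predecessor p y∈ = w , there w∈ , y≡

-- If a point recurred, injectivity would make its predecessor recur as well; applied to the point
-- `f x`, this puts the start x back on the path.
Path-unique : ∀ {f x us z} → (∀ {y y′} → f y ≡ f y′ → y ≡ y′) → Path f (f x) us z → x ∉ us → Unique us
Path-unique inj []                x∉ = []
Path-unique {f} {x} inj (step {us = us} p) x∉ = All.¬Any⇒All¬ us fx∉ ∷ Path-unique inj p fx∉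
  where
  fx∉ : f x ∉ us
  fx∉ fx∈ with w , w∈ , eq ← Path-predecessor p fx∈ = x∉ (subst (_∈ _) (sym (inj eq)) w∈)

Path-closed : ∀ {f x us z} {D : ℕ → Set} → (∀ {y} → D y → D (f y)) → D x → Path f x us z → All D us
Path-closed cl d []       = []
Path-closed cl d (step p) = d ∷ Path-closed cl (cl d) p

module _ {d} (ω : Sym d) where
  private
    tail : ℕ → List ℕ
    tail x = walk (ω ·_) x (length d) (ω · x)

  orbit-unique : ∀ x → Unique (toList (orbit ω x))
  orbit-unique x with _ , p , _ ← walk-path (ω ·_) x (length d) (ω · x) =
    subst (Unique ∘ toList) (sym (orbit≡walk ω x)) (All.¬Any⇒All¬ (tail x) x∉ ∷ Path-unique (·-injective ω) p x∉)
    where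
    x∉ : x ∉ tail x
    x∉ = start∉walk (ω ·_) x (length d) (ω · x)

  orbit⊆ : ∀ {x y} → x ∈ d → y ∈ toList (orbit ω x) → y ∈ d
  orbit⊆ {x} x∈ y∈ with _ , p , _ ← walk-path (ω ·_) x (length d) (ω · x) =
    All.lookup (Path-closed {f = ω ·_} (·-closed ω) x∈ (step p)) (subst (λ w → _ ∈ toList w) (orbit≡walk ω x) y∈)

  -- A walk of |d| steps that did not return to x would visit |d| + 1 points of d.
  orbit-isCycle : ∀ {x} → x ∈ d → IsCycle (ω ·_) (orbit ω x)
  orbit-isCycle {x} x∈ with walk-path (ω ·_) x (length d) (ω · x)
  ... | _ , p , inj₁ refl  = x , subst (λ w → Path (ω ·_) x (toList w) x) (sym (orbit≡walk ω x)) (step p)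
  ... | _ , p , inj₂ |w|≡l = contradiction (subst (λ w → length (toList w) ≤ length d) (orbit≡walk ω x)
          (Unique-⊆-length (orbit-unique x) (orbit⊆ x∈))) (λ le → ℕ.<-irrefl |w|≡l le)

  orbits-rotate : ∀ {x y z} → x ∈ d → y ∈ d → z ∈ toList (orbit ω x) → z ∈ toList (orbit ω y) →
                  Rotation (orbit ω x) (orbit ω y)
  orbits-rotate {x} {y} x∈ y∈ = cycles-through (orbit-isCycle x∈) (orbit-isCycle y∈) (orbit-unique x) (orbit-unique y)

least : ∀ x xs → ∃ λ y → y ∈ x ∷ xs × All (y ≤_) (x ∷ xs)
least x []        = x , here refl , ℕ.≤-refl ∷ []
least x (x′ ∷ xs) with y , y∈ , y≤ ← least x′ xs with ℕ.≤-total x y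
... | inj₁ x≤y = x , here refl , ℕ.≤-refl ∷ All.map (ℕ.≤-trans x≤y) y≤
... | inj₂ y≤x = y , there y∈ , y≤x ∷ y≤

AllPairs-mapWith : ∀ {X : Set} {P : X → Set} {R Q : X → X → Set} → (∀ {x y} → P x → P y → R x y → Q x y) →
                   ∀ {xs} → All P xs → AllPairs R xs → AllPairs Q xs
AllPairs-mapWith f []       []       = []
AllPairs-mapWith f (p ∷ ps) (r ∷ rs) =
  All.zipWith (λ (p′ , r′) → f p p′ r′) (ps , r) ∷ AllPairs-mapWith f ps rs

cycleNotation-decomposition : ∀ {d} (ω : Sym d) → Unique d →
                              CycleDecomposition (ω ·_) (_∈ d) (cycleNotation ω)
cycleNotation-decomposition {d} ω d! = record
  { cyclic = All.map⁺ (All.map (orbit-isCycle ω ∘ proj₁) leaders)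
  ; unique = Unique.concat⁺ (All.map⁺ (All.map⁺ (All.map (λ {x} _ → orbit-unique ω x) leaders)))
               (AllPairs.map⁺ (AllPairs.map⁺ (AllPairs-mapWith disjoint leaders (Unique.filter⁺ leader? d!))))
  ; sound  = sound′
  ; covers = covers′
  }
  where
  Leader : ℕ → Set
  Leader x = All (x ≤_) (toList (orbit ω x))

  leader? : ∀ x → Dec (Leader x)
  leader? x = All.all? (x ≤?_) (toList (orbit ω x))

  leaders : All (λ x → x ∈ d × Leader x) (filter leader? d)
  leaders = All.tabulate (λ x∈ → ∈-filter⁻ leader? {xs = d} x∈)

  leader≤ : ∀ {x y z} → x ∈ d × Leader x → y ∈ d × Leader y →
            z ∈ toList (orbit ω x) → z ∈ toList (orbit ω y) → x ≤ y
  -- The orbits share z, hence are rotations of each other, so y occurs in the orbit of x, of which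
  -- x is a least entry.
  leader≤ (x∈ , lx) (y∈ , _) z∈x z∈y =
    All.lookup lx (∈-resp-↭ (Rotation⇒↭ (orbits-rotate ω y∈ x∈ z∈y z∈x)) (here refl))

  disjoint : ∀ {x y} → x ∈ d × Leader x → y ∈ d × Leader y → x ≢ y →
             ∀ {z} → ¬ (z ∈ toList (orbit ω x) × z ∈ toList (orbit ω y))
  disjoint lx ly x≢y (z∈x , z∈y) = x≢y (ℕ.≤-antisym (leader≤ lx ly z∈x z∈y) (leader≤ ly lx z∈y z∈x))

  sound′ : ∀ {x} → x ∈ concatMap toList (cycleNotation ω) → x ∈ d
  sound′ {x} x∈
    with w , w∈ , x∈w ← find (∈-concatMap⁻ toList {xs = cycleNotation ω} x∈)
    with y , y∈ , refl ← ∈-map⁻ (orbit ω) w∈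
    = orbit⊆ ω (proj₁ (∈-filter⁻ leader? {xs = d} y∈)) x∈w

  covers′ : ∀ {x} → x ∈ d → x ∈ concatMap toList (cycleNotation ω)
  -- The least entry y of the orbit of x is a leader, because the orbit of y is a rotation of that
  -- of x and has the same entries.
  covers′ {x} x∈
    with y , y∈ , y≤ ← least x (List⁺.tail (orbit ω x))
    with rot ← orbits-rotate ω x∈ (orbit⊆ ω x∈ y∈) y∈ (here refl)
    = ∈-concatMap⁺ toList (Any.map (λ { refl → ∈-resp-↭ (Rotation⇒↭ rot) (here refl) })
        (∈-map⁺ (orbit ω) (∈-filter⁺ leader? (orbit⊆ ω x∈ y∈)
          (All.tabulate (λ z∈ → All.lookup y≤ (∈-resp-↭ (↭-sym (Rotation⇒↭ rot)) z∈))))))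

-- Marked cycle types

≥⇒mark : ∀ {m x} → m ≤ x → mark m x ≡ ∗
≥⇒mark {m} {x} m≤x with x <? m
... | yes x<m = contradiction m≤x (ℕ.<⇒≱ x<m)
... | no  _   = refl

mark⇒≥ : ∀ {m x} → mark m x ≡ ∗ → m ≤ x
mark⇒≥ {m} {x} eq with x <? m
... | no x≮m = ℕ.≮⇒≥ x≮m

mark-toℕ : ∀ {m} (i : Fin m) → mark m (toℕ i) ≡ just i
mark-toℕ {m} i with toℕ i <? m
... | yes i<m = cong just (Fin.fromℕ<-toℕ i i<m)
... | no  i≮m = contradiction (Fin.toℕ<n i) i≮m

-- By injectivity a permutation that fixes [m] pointwise cannot carry a point from outside [m] into
-- it.
mark-↔ : ∀ {m} (π : ℕ ↔ ℕ) → (∀ {x} → x < m → Inverse.to π x ≡ x) → ∀ x → mark m (Inverse.to π x) ≡ mark m x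
mark-↔ {m} π fixes x with ℕ.<-≤-connex x m
... | inj₁ x<m = cong (mark m) (fixes x<m)
... | inj₂ m≤x = trans (≥⇒mark (ℕ.≮⇒≥ λ πx<m →
                   ℕ.<⇒≱ πx<m (subst (m ≤_) (sym (↔-injective π (fixes πx<m))) m≤x)))
                 (sym (≥⇒mark m≤x))

relabel : ∀ {X Y : Set} → (X → Y) → List (List⁺ X) → List (List⁺ Y)
relabel g = map (List⁺.map g)

relabel-↭ᶜ : ∀ {X Y : Set} (g : X → Y) {cs cs′} → cs ↭ᶜ cs′ → relabel g cs ↭ᶜ relabel g cs′
relabel-↭ᶜ g = ↭ₛ.map⁺ (rotationSetoid _) (rotationSetoid _) λ (xs , ys , v≡ , w≡) →
  map g xs , map g ys , trans (cong (map g) v≡) (List.map-++ g xs ys) , trans (cong (map g) w≡) (List.map-++ g ys xs)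

relabel-entries : ∀ {X Y : Set} (g : X → Y) cs → concatMap toList (relabel g cs) ≡ map g (concatMap toList cs)
relabel-entries g []       = refl
relabel-entries g (w ∷ cs) = trans (cong (map g (toList w) ++_) (relabel-entries g cs))
                                   (sym (List.map-++ g (toList w) (concatMap toList cs)))

markedCycles-decomposition : ∀ {m d cs} (ω : Sym d) → Unique d → CycleDecomposition (ω ·_) (_∈ d) cs →
                             markedCycles m ω ↭ᶜ relabel (mark m) cs
markedCycles-decomposition {m} ω d! c =
  relabel-↭ᶜ (mark m) (decomposition-unique (cycleNotation-decomposition ω d!) c)

fixedPoints : ∀ {X : Set} → List X → List (List⁺ X)
fixedPoints = map (_∷ [])

fixedPoints-entries : ∀ {X : Set} (F : List X) cs →
                      concatMap toList (fixedPoints F ++ cs) ≡ F ++ concatMap toList cs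
fixedPoints-entries []      cs = refl
fixedPoints-entries (x ∷ F) cs = cong (x ∷_) (fixedPoints-entries F cs)

relabel-fixedPoints : ∀ {m F} cs → All (m ≤_) F →
                      relabel (mark m) (fixedPoints F ++ cs) ≡ replicate (length F) (∗ ∷ []) ++ relabel (mark m) cs
relabel-fixedPoints cs []           = refl
relabel-fixedPoints cs (m≤x ∷ m≤F) = cong₂ _∷_ (cong (_∷ []) (≥⇒mark m≤x)) (relabel-fixedPoints cs m≤F)

Path-cong : ∀ {f g x us y} → (∀ {z} → z ∈ us → f z ≡ g z) → Path f x us y → Path g x us y
Path-cong f≗g []               = []
Path-cong {g = g} f≗g (step p) =
  step (subst (λ z → Path g z _ _) (f≗g (here refl)) (Path-cong (f≗g ∘ there) p))

IsCycle-singleton : ∀ {f x} → f x ≡ x → IsCycle f (x ∷ [])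
IsCycle-singleton {f} {x} fx≡x = x , step (subst (λ z → Path f z [] x) (sym fx≡x) [])

-- The old cycles together with the one-point cycles of F decompose the larger set. With F empty
-- this also shows that the type depends only on the domain as a set and on the values of the
-- permutation.
markedCycles-extend : ∀ {m d d′ F} (ω : Sym d) (ω′ : Sym d′) → Unique d → Unique d′ → Unique F →
                      (∀ x → ω · x ≡ ω′ · x) → All (m ≤_) F → (∀ {x} → x ∈ F → x ∉ d) →
                      (∀ {x} → x ∈ F ++ d → x ∈ d′) → (∀ {x} → x ∈ d′ → x ∈ F ++ d) →
                      markedCycles m ω′ ↭ᶜ replicate (length F) (∗ ∷ []) ++ markedCycles m ω
markedCycles-extend {m} {d} {d′} {F} ω ω′ d! d′! F! ω≗ω′ m≤F F#d to from =
  ↭ᶜ-trans (markedCycles-decomposition ω′ d′! c′) (↭ᶜ-reflexive (relabel-fixedPoints cs m≤F))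
  where
  cs = cycleNotation ω
  c  = cycleNotation-decomposition ω d!

  entries : concatMap toList (fixedPoints F ++ cs) ≡ F ++ concatMap toList cs
  entries = fixedPoints-entries F cs

  fixed : ∀ {x} → x ∈ F → ω′ · x ≡ x
  fixed x∈F = trans (sym (ω≗ω′ _)) (fixesRest ω (F#d x∈F))

  c′ : CycleDecomposition (ω′ ·_) (_∈ d′) (fixedPoints F ++ cs)
  c′ = record
    { cyclic = All.++⁺ (All.map⁺ (All.tabulate (IsCycle-singleton ∘ fixed)))
                       (All.map (λ (x , p) → x , Path-cong (λ _ → ω≗ω′ _) p) (cyclic c))
    ; unique = subst Unique (sym entries)
                 (Unique.++⁺ F! (unique c) (λ (x∈F , x∈cs) → F#d x∈F (sound c x∈cs)))
    ; sound  = λ x∈ → to ([ ∈-++⁺ˡ , (λ x∈cs → ∈-++⁺ʳ F (sound c x∈cs)) ]′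
                           (∈-++⁻ F (subst (_ ∈_) entries x∈)))
    ; covers = λ x∈ → subst (_ ∈_) (sym entries)
                        ([ ∈-++⁺ˡ , (λ x∈d → ∈-++⁺ʳ F (covers c x∈d)) ]′ (∈-++⁻ F (from x∈)))
    }

Path-conjugate : ∀ {f g x us y} (π : ℕ → ℕ) → (∀ z → g (π z) ≡ π (f z)) →
                 Path f x us y → Path g (π x) (map π us) (π y)
Path-conjugate π gπ≗πf []       = []
Path-conjugate {g = g} π gπ≗πf (step p) =
  step (subst (λ z → Path g z _ _) (sym (gπ≗πf _)) (Path-conjugate π gπ≗πf p))

-- Applying `π` to every entry turns a decomposition for `ω` into one for its conjugate `ω′`, and
-- the marks do not change since `π` fixes [m].
markedCycles-conjugate : ∀ {m d d′} (ω : Sym d) (ω′ : Sym d′) (π : ℕ ↔ ℕ) → Unique d → Unique d′ →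
                         (∀ {x} → x < m → Inverse.to π x ≡ x) →
                         (∀ x → ω′ · Inverse.to π x ≡ Inverse.to π (ω · x)) →
                         (∀ {x} → x ∈ d → Inverse.to π x ∈ d′) → (∀ {x} → x ∈ d′ → Inverse.from π x ∈ d) →
                         markedCycles m ω′ ↭ᶜ markedCycles m ω
markedCycles-conjugate {m} {d} {d′} ω ω′ π d! d′! fixes conj to from =
  ↭ᶜ-trans (markedCycles-decomposition ω′ d′! c′) (↭ᶜ-reflexive relabelled)
  where
  cs = cycleNotation ω
  c  = cycleNotation-decomposition ω d!
  f  = Inverse.to π

  relabelled : relabel (mark m) (relabel f cs) ≡ relabel (mark m) cs
  relabelled = trans (sym (List.map-∘ cs)) (List.map-cong
    (λ (x ∷ xs) → cong₂ _∷_ (mark-↔ π fixes x) (trans (sym (List.map-∘ xs)) (List.map-cong (mark-↔ π fixes) xs))) cs)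

  c′ : CycleDecomposition (ω′ ·_) (_∈ d′) (relabel f cs)
  c′ = record
    { cyclic = All.map⁺ (All.map (λ (x , p) → f x , Path-conjugate f conj p) (cyclic c))
    ; unique = subst Unique (sym (relabel-entries f cs)) (Unique.map⁺ (↔-injective π) (unique c))
    ; sound  = λ x∈ → let y , y∈ , x≡ = ∈-map⁻ f (subst (_ ∈_) (relabel-entries f cs) x∈)
                      in subst (_∈ d′) (sym x≡) (to (sound c y∈))
    ; covers = λ x∈ → subst (_ ∈_) (sym (relabel-entries f cs))
                        (subst (_∈ map f (concatMap toList cs)) (Inverse.strictlyInverseˡ π _)
                          (∈-map⁺ f (covers c (from x∈))))
    }

-- Numbers of stars and of cycles (∗)

stars : ∀ {m} → List (List⁺ (Letter m)) → ℕ
stars cs = occurrences ∗ (concatMap toList cs)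

stars-↭ᶜ : ∀ {m} {cs cs′ : List (List⁺ (Letter m))} → cs ↭ᶜ cs′ → stars cs ≡ stars cs′
stars-↭ᶜ p = ↭-length (filter-↭ (∗ ≟ᴸ_) (entries-↭ p))

stars-replicate : ∀ {m} k (cs : List (List⁺ (Letter m))) → stars (replicate k (∗ ∷ []) ++ cs) ≡ k + stars cs
stars-replicate zero    cs = refl
stars-replicate (suc k) cs = cong suc (stars-replicate k cs)

occurrences-mark : ∀ m xs → occurrences ∗ (map (mark m) xs) ≡ length (filter (m ≤?_) xs)
occurrences-mark m []       = refl
occurrences-mark m (x ∷ xs) with m ≤? x
... | yes m≤x = trans (cong length (List.filter-accept (∗ ≟ᴸ_) (sym (≥⇒mark m≤x))))
  (trans (cong suc (occurrences-mark m xs)) (sym (cong length (List.filter-accept (m ≤?_) m≤x))))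
... | no  m≰x = trans (cong length (List.filter-reject (∗ ≟ᴸ_) (m≰x ∘ mark⇒≥ ∘ sym)))
  (trans (occurrences-mark m xs) (sym (cong length (List.filter-reject (m ≤?_) m≰x))))

-- The entries of the cycle notation are the elements of [n], once each, and exactly those from m on
-- become stars.
stars-markedCycles : ∀ {m n} (ω : Sym (upTo n)) → m ≤ n → stars (markedCycles m ω) ≡ n ∸ m
stars-markedCycles {m} {n} ω m≤n = begin
  occurrences ∗ (concatMap toList (markedCycles m ω))                 ≡⟨ cong (occurrences ∗) (relabel-entries (mark m) cs) ⟩
  occurrences ∗ (map (mark m) (concatMap toList cs))                  ≡⟨ occurrences-mark m (concatMap toList cs) ⟩
  length (filter (m ≤?_) (concatMap toList cs))                       ≡⟨ ℕ.≤-antisym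
      (Unique-⊆-length (Unique.filter⁺ (m ≤?_) (unique c)) to)
      (Unique-⊆-length above! from) ⟩
  length (applyUpTo (_+_ m) (n ∸ m))                                  ≡⟨ List.length-applyUpTo (_+_ m) (n ∸ m) ⟩
  n ∸ m                                                               ∎
  where
  open ≡-Reasoning
  cs = cycleNotation ω
  c  = cycleNotation-decomposition ω (Unique.upTo⁺ n)

  above! : Unique (applyUpTo (_+_ m) (n ∸ m))
  above! = Unique.applyUpTo⁺₁ (_+_ m) (n ∸ m) (λ i<j _ → ℕ.<⇒≢ (ℕ.+-monoʳ-< m i<j))

  to : ∀ {x} → x ∈ filter (m ≤?_) (concatMap toList cs) → x ∈ applyUpTo (_+_ m) (n ∸ m)
  to x∈ with x∈cs , m≤x ← ∈-filter⁻ (m ≤?_) {xs = concatMap toList cs} x∈ =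
    subst (_∈ _) (ℕ.m+[n∸m]≡n m≤x) (∈-applyUpTo⁺ (_+_ m) (ℕ.∸-monoˡ-< (∈-upTo⁻ (sound c x∈cs)) m≤x))

  from : ∀ {x} → x ∈ applyUpTo (_+_ m) (n ∸ m) → x ∈ filter (m ≤?_) (concatMap toList cs)
  from x∈ with i , i< , refl ← ∈-applyUpTo⁻ (_+_ m) x∈ = ∈-filter⁺ (m ≤?_)
    (covers c (∈-upTo⁺ (subst (m + i <_) (ℕ.m+[n∸m]≡n m≤n) (ℕ.+-monoʳ-< m i<)))) (ℕ.m≤m+n m i)

IsStar : ∀ {m} → List⁺ (Letter m) → Set
IsStar w = toList w ≡ [ ∗ ]

isStar? : ∀ {m} (w : List⁺ (Letter m)) → Dec (IsStar w)
isStar? w = List.≡-dec _≟ᴸ_ (toList w) [ ∗ ]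

starCycles : ∀ {m} → List (List⁺ (Letter m)) → ℕ
starCycles cs = length (filter isStar? cs)

starCycles-↭ᶜ : ∀ {m} {cs cs′ : List (List⁺ (Letter m))} → cs ↭ᶜ cs′ → starCycles cs ≡ starCycles cs′
starCycles-↭ᶜ p = ↭ₛ.xs↭ys⇒|xs|≡|ys| (rotationSetoid _) (↭ₛ.filter⁺ (rotationSetoid _) isStar?
  (λ r v≡ → ↭-singleton-inv (↭-trans (↭-sym (Rotation⇒↭ r)) (↭-reflexive v≡))) p)

starCycles-replicate : ∀ {m} k (cs : List (List⁺ (Letter m))) →
                       starCycles (replicate k (∗ ∷ []) ++ cs) ≡ k + starCycles cs
starCycles-replicate zero    cs = refl
starCycles-replicate (suc k) cs = cong suc (starCycles-replicate k cs)

replicate-cancel : ∀ {m} k {cs cs′ : List (List⁺ (Letter m))} →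
                   replicate k (∗ ∷ []) ++ cs ↭ᶜ replicate k (∗ ∷ []) ++ cs′ → cs ↭ᶜ cs′
replicate-cancel zero    p = p
replicate-cancel (suc k) p = replicate-cancel k (↭ₛ.drop-∷ (rotationSetoid _) p)

-- A fixed point x outside [m] would form a cycle by itself, and that cycle would be marked (∗).
starCycles≡0⇒moves : ∀ {m d x} (ω : Sym d) → Unique d → starCycles (markedCycles m ω) ≡ 0 →
                     x ∈ d → m ≤ x → ω · x ≢ x
starCycles≡0⇒moves {m} {d} {x} ω d! ≡0 x∈d m≤x ωx≡x
  with w , w∈ , x∈w ← find (∈-concatMap⁻ toList {xs = cycleNotation ω} (covers (cycleNotation-decomposition ω d!) x∈d))
  = contradiction ≡0 (ℕ.>⇒≢ (∈-length (∈-filter⁺ isStar? (∈-map⁺ (List⁺.map (mark m)) w∈) (star w∈ x∈w))))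
  where
  c = cycleNotation-decomposition ω d!

  star : ∀ {w} → w ∈ cycleNotation ω → x ∈ toList w → IsStar (List⁺.map (mark m) w)
  star {w} w∈ x∈w with y , _ , refl ← ∈-map⁻ (orbit ω) w∈ = trans
    (cong (map (mark m)) (↭-singleton-inv (Rotation⇒↭
      (cycles-through (All.lookup (cyclic c) w∈) (IsCycle-singleton ωx≡x) (orbit-unique ω y) ([] ∷ []) x∈w (here refl)))))
    (cong (_∷ []) (≥⇒mark m≤x))

moves⇒starCycles≡0 : ∀ {m d} (ω : Sym d) → Unique d → (∀ {x} → x ∈ d → m ≤ x → ω · x ≢ x) →
                     starCycles (markedCycles m ω) ≡ 0
moves⇒starCycles≡0 {m} {d} ω d! moves = cong length (List.filter-none isStar? (All.map⁺ (All.tabulate noStar)))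
  where
  c = cycleNotation-decomposition ω d!

  noStar : ∀ {w} → w ∈ cycleNotation ω → ¬ IsStar (List⁺.map (mark m) w)
  noStar {x ∷ []} w∈ eq with _ , step p ← All.lookup (cyclic c) w∈ =
    moves (sound c (∈-concatMap⁺ toList (Any.map (λ { refl → here refl }) w∈)))
          (mark⇒≥ (List.∷-injectiveˡ eq)) (end p)
    where
    end : ∀ {f x y} → Path f x [] y → x ≡ y
    end [] = refl

-- Every marked cycle shape is the type of a permutation

widen : ∀ {d d′} → (∀ {x} → x ∈ d → x ∈ d′) → Sym d → Sym d′
widen d⊆d′ ω = record { extension = extension ω ; fixesRest = λ x∉ → fixesRest ω (x∉ ∘ d⊆d′) }

identity : ∀ {d} → Sym d
identity = record { extension = ↔-id ℕ ; fixesRest = λ _ → refl }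

-- (x₀ x₁ … xₖ) = (x₀ x₁) ∘ (x₁ x₂) ∘ … ∘ (xₖ₋₁ xₖ)
cyclePerm : ∀ x xs → Sym (x ∷ xs)
cyclePerm x []       = identity
cyclePerm x (y ∷ ys) = compose id there (transposition (here refl) (there (here refl))) (cyclePerm y ys)

step′ : ∀ {f x x′ us y} → f x ≡ x′ → Path f x′ us y → Path f x (x ∷ us) y
step′ refl p = step p

-- The points x and y do not occur in `us`, so the transposition leaves every arrow alone except the
-- last one, which is diverted from y to x.
Path-redirect : ∀ {g x y us z} → Path g (g z) us y → x ∉ us → y ∉ us → Path (transpose x y ∘ g) z (z ∷ us) x
Path-redirect {g} {x} {y} {us} {z} p x∉ y∉ = go p refl
  where
  go : ∀ {z′} → Path g z′ us y → g z ≡ z′ → Path (transpose x y ∘ g) z (z ∷ us) x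
  go []       gz≡y  = step′ (trans (cong (transpose x y) gz≡y) (transpose-right x y)) []
  go (step p) gz≡z′ = step′
    (trans (cong (transpose x y) gz≡z′) (transpose-rest (λ { refl → x∉ (here refl) }) (λ { refl → y∉ (here refl) })))
    (Path-redirect p (x∉ ∘ there) (y∉ ∘ there))

cyclePerm-path : ∀ x xs → Unique (x ∷ xs) → Path (cyclePerm x xs ·_) x (x ∷ xs) x
cyclePerm-path x []       u = step []
cyclePerm-path x (y ∷ ys) (x≢ ∷ u) with step p ← cyclePerm-path y ys u = step′
  (trans (cong (transpose x y) (fixesRest (cyclePerm y ys) x∉)) (transpose-left x y))
  (Path-redirect p (x∉ ∘ there) (Unique.Unique[x∷xs]⇒x∉xs u))
  where
  x∉ : x ∉ y ∷ ys
  x∉ = All.All¬⇒¬Any x≢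

cyclesPerm : (cs : List (List⁺ ℕ)) → Sym (concatMap toList cs)
cyclesPerm []              = identity
cyclesPerm ((x ∷ xs) ∷ cs) = compose (∈-++⁺ʳ (x ∷ xs)) ∈-++⁺ˡ (cyclesPerm cs) (cyclePerm x xs)

cyclesPerm-cyclic : ∀ cs → Unique (concatMap toList cs) → All (IsCycle (cyclesPerm cs ·_)) cs
cyclesPerm-cyclic []       u = []
cyclesPerm-cyclic ((x ∷ xs) ∷ cs) u =
  (x , Path-cong (λ z∈w → sym (fixesRest (cyclesPerm cs) (w#cs (·-closed (cyclePerm x xs) z∈w))))
                 (cyclePerm-path x xs (Unique-++⁻ˡ (x ∷ xs) u))) ∷
  All.tabulate (λ {v} v∈ → let y , p = All.lookup (cyclesPerm-cyclic cs (Unique-++⁻ʳ (x ∷ xs) u)) v∈ in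
    y , Path-cong (λ z∈v → cong (cyclesPerm cs ·_) (sym (fixesRest (cyclePerm x xs)
          (λ z∈w → w#cs z∈w (∈-concatMap⁺ toList (Any.map (λ { refl → z∈v }) v∈)))))) p)
  where
  w#cs : ∀ {z} → z ∈ x ∷ xs → z ∉ concatMap toList cs
  w#cs = Unique-++⇒disjoint (x ∷ xs) u

-- A section of `mark` on words. Started at c = m, it numbers the stars m, m + 1, ..., so the
-- entries of a shape become the numbers below its size.
label : ∀ {m} → ℕ → List (Letter m) → List ℕ
label c []            = []
label c (just i ∷ ls) = toℕ i ∷ label c ls
label c (∗ ∷ ls)      = c ∷ label (suc c) ls

mark-label : ∀ {m c} → m ≤ c → (ls : List (Letter m)) → map (mark m) (label c ls) ≡ ls
mark-label m≤c []            = refl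
mark-label m≤c (just i ∷ ls) = cong₂ _∷_ (mark-toℕ i) (mark-label m≤c ls)
mark-label m≤c (∗ ∷ ls)      = cong₂ _∷_ (≥⇒mark m≤c) (mark-label (ℕ.m≤n⇒m≤1+n m≤c) ls)

∈-label⁻ : ∀ {m x} c (ls : List (Letter m)) → x ∈ label c ls →
           (∃ λ i → x ≡ toℕ i × just i ∈ ls) ⊎ (c ≤ x × x < c + occurrences ∗ ls)
∈-label⁻ c (just i ∷ ls) (here x≡) = inj₁ (i , x≡ , here refl)
∈-label⁻ c (just i ∷ ls) (there x∈) with ∈-label⁻ c ls x∈
... | inj₁ (j , x≡ , j∈) = inj₁ (j , x≡ , there j∈)
... | inj₂ bounds        = inj₂ bounds
∈-label⁻ c (∗ ∷ ls) (here refl) = inj₂ (ℕ.≤-refl , ℕ.m<m+n c (s≤s z≤n))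
∈-label⁻ {x = x} c (∗ ∷ ls) (there x∈) with ∈-label⁻ (suc c) ls x∈
... | inj₁ (j , x≡ , j∈) = inj₁ (j , x≡ , there j∈)
... | inj₂ (c<x , x<)    = inj₂ (ℕ.<⇒≤ c<x , subst (x <_) (sym (ℕ.+-suc c (occurrences ∗ ls))) x<)

just∈-label⁺ : ∀ {m} {i : Fin m} c {ls} → just i ∈ ls → toℕ i ∈ label c ls
just∈-label⁺ c {just j ∷ ls} (here refl) = here refl
just∈-label⁺ c {just j ∷ ls} (there i∈)  = there (just∈-label⁺ c i∈)
just∈-label⁺ c {∗ ∷ ls}      (there i∈)  = there (just∈-label⁺ (suc c) i∈)

star∈-label⁺ : ∀ {m x} c (ls : List (Letter m)) → c ≤ x → x < c + occurrences ∗ ls → x ∈ label c ls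
star∈-label⁺ {x = x} c []  c≤x x< = contradiction c≤x (ℕ.<⇒≱ (subst (x <_) (ℕ.+-identityʳ c) x<))
star∈-label⁺ c (just i ∷ ls) c≤x x< = there (star∈-label⁺ c ls c≤x x<)
star∈-label⁺ {x = x} c (∗ ∷ ls) c≤x x< with ℕ.m≤n⇒m<n∨m≡n c≤x
... | inj₁ c<x  = there (star∈-label⁺ (suc c) ls c<x (subst (x <_) (ℕ.+-suc c (occurrences ∗ ls)) x<))
... | inj₂ refl = here refl

occurrences-tail : ∀ {m} (x y : Letter m) ls → occurrences x ls ≤ occurrences x (y ∷ ls)
occurrences-tail x y ls with x ≟ᴸ y
... | yes _ = ℕ.n≤1+n _
... | no  _ = ℕ.≤-refl

label-unique : ∀ {m c} → m ≤ c → (ls : List (Letter m)) → (∀ i → occurrences (just i) ls ≤ 1) → Unique (label c ls)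
label-unique m≤c []       once = []
label-unique {m} {c} m≤c (just i ∷ ls) once =
  All.¬Any⇒All¬ (label c ls) i∉ ∷ label-unique m≤c ls (λ j → ℕ.≤-trans (occurrences-tail (just j) (just i) ls) (once j))
  where
  i∉ : toℕ i ∉ label c ls
  i∉ i∈ with ∈-label⁻ c ls i∈
  ... | inj₁ (j , i≡j , j∈) = ℕ.<⇒≱ (s≤s (∈-length (∈-filter⁺ (just i ≟ᴸ_) j∈ (cong just (Fin.toℕ-injective i≡j)))))
          (subst (_≤ 1) (cong length (List.filter-accept (just i ≟ᴸ_) {x = just i} {xs = ls} refl)) (once i))
  ... | inj₂ (c≤i , _)      = ℕ.<⇒≱ (Fin.toℕ<n i) (ℕ.≤-trans m≤c c≤i)
label-unique {m} {c} m≤c (∗ ∷ ls) once =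
  All.¬Any⇒All¬ (label (suc c) ls) c∉ ∷ label-unique (ℕ.m≤n⇒m≤1+n m≤c) ls once
  where
  c∉ : c ∉ label (suc c) ls
  c∉ c∈ with ∈-label⁻ (suc c) ls c∈
  ... | inj₁ (j , c≡j , _) = ℕ.<⇒≱ (Fin.toℕ<n j) (subst (m ≤_) c≡j m≤c)
  ... | inj₂ (c<c , _)     = ℕ.<-irrefl refl c<c

map-++⁻ : ∀ {X Y : Set} {g : X → Y} xs us {vs} → map g xs ≡ us ++ vs →
          ∃₂ λ ys zs → xs ≡ ys ++ zs × map g ys ≡ us × map g zs ≡ vs
map-++⁻ xs       []       eq = [] , xs , refl , refl , eq
map-++⁻ (x ∷ xs) (u ∷ us) eq with gx≡u , eq′ ← List.∷-injective eq
  with ys , zs , xs≡ , ys≡ , zs≡ ← map-++⁻ xs us eq′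
  = x ∷ ys , zs , cong (x ∷_) xs≡ , cong₂ _∷_ gx≡u ys≡ , zs≡

-- The flat list `xs` is cut into words of the lengths prescribed by `cs`.
group : ∀ {X Y : Set} {g : X → Y} xs cs → map g xs ≡ concatMap toList cs →
        ∃ λ cs′ → relabel g cs′ ≡ cs × concatMap toList cs′ ≡ xs
group []       []       eq = [] , refl , refl
group xs ((u ∷ us) ∷ cs) eq with map-++⁻ xs (u ∷ us) eq
... | y ∷ ys , zs , refl , refl , zs≡ with cs′ , refl , entries≡ ← group zs cs zs≡ =
  (y ∷ ys) ∷ cs′ , refl , cong ((y ∷ ys) ++_) entries≡

-- A coefficient can only be observed at permutations of its type, so every shape needs one.
-- Labelling the entries of ρ by distinct numbers gives cycles on {0, ..., |ρ| - 1}, and the product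
-- of these cycles has type ρ.
realise : ∀ {m} (ρ : Shape m) → Σ[ ω ∈ Sym (upTo (size ρ)) ] HasType ω ρ
realise {m} ρ with cs , relabelled , entries≡ ← group (label m (concatMap toList (cycles ρ))) (cycles ρ)
                                              (mark-label ℕ.≤-refl (concatMap toList (cycles ρ)))
  = ω , ↭ᶜ-trans (markedCycles-decomposition ω (Unique.upTo⁺ _) decomposition) (↭ᶜ-reflexive relabelled)
  where
  ls = concatMap toList (cycles ρ)

  ls! : Unique (concatMap toList cs)
  ls! = subst Unique (sym entries≡) (label-unique ℕ.≤-refl ls (λ i → ℕ.≤-reflexive (onceEach ρ i)))

  bounded : ∀ {x} → x ∈ concatMap toList cs → x ∈ upTo (size ρ)
  bounded x∈ with ∈-label⁻ m ls (subst (_ ∈_) entries≡ x∈)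
  ... | inj₁ (i , refl , _) = ∈-upTo⁺ (ℕ.≤-trans (Fin.toℕ<n i) (ℕ.m≤m+n m _))
  ... | inj₂ (_ , x<)       = ∈-upTo⁺ x<

  covered : ∀ {x} → x < size ρ → x ∈ label m ls
  covered {x} x< with x <? m
  ... | no  x≮m = star∈-label⁺ m ls (ℕ.≮⇒≥ x≮m) x<
  -- The mark x occurs exactly once in ρ, so the filtered list of its occurrences has an element.
  ... | yes x<m with ∈-length⁻ (ℕ.≤-reflexive (sym (onceEach ρ (fromℕ< x<m))))
    where
    ∈-length⁻ : ∀ {X : Set} {xs : List X} → 0 < length xs → ∃ (_∈ xs)
    ∈-length⁻ {xs = x ∷ _} _ = x , here refl
  ...   | y , y∈ with y∈ls , refl ← ∈-filter⁻ (just (fromℕ< x<m) ≟ᴸ_) {xs = ls} y∈ =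
    subst (_∈ label m ls) (Fin.toℕ-fromℕ< x<m) (just∈-label⁺ m y∈ls)

  ω : Sym (upTo (size ρ))
  ω = widen bounded (cyclesPerm cs)

  decomposition : CycleDecomposition (ω ·_) (_∈ upTo (size ρ)) cs
  decomposition = record
    { cyclic = cyclesPerm-cyclic cs ls!
    ; unique = ls!
    ; sound  = bounded
    ; covers = λ x∈ → subst (_ ∈_) (sym entries≡) (covered (∈-upTo⁻ x∈))
    }

-- Completeness and irredundancy of the enumerations

module _ {X Y : Set} where
  ∈-mapWith∈⁺ : ∀ {xs : List X} (f : ∀ {x} → x ∈ xs → Y) {x} (x∈ : x ∈ xs) → f x∈ ∈ mapWith∈ xs f
  ∈-mapWith∈⁺ f (here refl) = here refl
  ∈-mapWith∈⁺ f (there x∈)  = there (∈-mapWith∈⁺ (f ∘ there) x∈)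

  All-mapWith∈⁺ : ∀ {P : Y → Set} (xs : List X) (f : ∀ {x} → x ∈ xs → Y) → (∀ {x} (x∈ : x ∈ xs) → P (f x∈)) →
                  All P (mapWith∈ xs f)
  All-mapWith∈⁺ []       f p = []
  All-mapWith∈⁺ (x ∷ xs) f p = p (here refl) ∷ All-mapWith∈⁺ xs (f ∘ there) (p ∘ there)

  AllPairs-mapWith∈⁺ : ∀ {R : Y → Y → Set} {xs : List X} (f : ∀ {x} → x ∈ xs → Y) → Unique xs →
                       (∀ {x y} (x∈ : x ∈ xs) (y∈ : y ∈ xs) → x ≢ y → R (f x∈) (f y∈)) →
                       AllPairs R (mapWith∈ xs f)
  AllPairs-mapWith∈⁺ f []       r = []
  AllPairs-mapWith∈⁺ {xs = x ∷ xs} f (x∉ ∷ u) r =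
    All-mapWith∈⁺ xs (f ∘ there) (λ y∈ → r (here refl) (there y∈) (All.lookup x∉ y∈)) ∷
    AllPairs-mapWith∈⁺ (f ∘ there) u (λ x∈ y∈ → r (there x∈) (there y∈))

-- Permutations in different rows differ in the image of x: those of d fix x, and the transposition
-- then sends it to the y of the row. Within a row the transposition cancels by injectivity.
permutations-unique : ∀ {d} → Unique d → AllPairs (λ ω ω′ → ¬ ω ≈ₛ ω′) (permutations d)
permutations-unique {[]}    []       = [] ∷ []
permutations-unique {x ∷ d} (x≢ ∷ u) = AllPairs.concat⁺
  (All-mapWith∈⁺ (x ∷ d) row row-unique) (AllPairs-mapWith∈⁺ row (x≢ ∷ u) rows-distinct)
  where
  via : ∀ {y} → y ∈ x ∷ d → Sym d → Sym (x ∷ d)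
  via y∈ = compose id there (transposition (here refl) y∈)

  row : ∀ {y} → y ∈ x ∷ d → List (Sym (x ∷ d))
  row y∈ = map (via y∈) (permutations d)

  row-unique : ∀ {y} (y∈ : y ∈ x ∷ d) → AllPairs (λ ω ω′ → ¬ ω ≈ₛ ω′) (row y∈)
  row-unique y∈ = AllPairs.map⁺ {f = via y∈} (AllPairs.map
    (λ ω≉ω′ eq → ω≉ω′ (All.map (·-injective (transposition (here refl) y∈)) (All.tail eq)))
    (permutations-unique u))

  image : ∀ (ω : Sym d) y → transpose x y (ω · x) ≡ y
  image ω y = trans (cong (transpose x y) (fixesRest ω (All.All¬⇒¬Any x≢))) (transpose-left x y)

  rows-distinct : ∀ {y y′} (y∈ : y ∈ x ∷ d) (y′∈ : y′ ∈ x ∷ d) → y ≢ y′ →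
                  All (λ ω → All (λ ω′ → ¬ ω ≈ₛ ω′) (row y′∈)) (row y∈)
  rows-distinct {y} {y′} y∈ y′∈ y≢y′ =
    All.map⁺ {f = via y∈} (All.tabulate λ {ω} _ → All.map⁺ {f = via y′∈} (All.tabulate λ {ω′} _ eq →
      y≢y′ (trans (sym (image ω y)) (trans (All.head eq) (image ω′ y′)))))

-- Composing `ω` with the transposition of x and `ω · x` yields a permutation that fixes x, hence
-- one of d, to which induction applies; the transposition is its own inverse.
permutations-complete : ∀ {d} → (ω : Sym d) → ∃ λ ω′ → ω′ ∈ permutations d × (∀ x → ω · x ≡ ω′ · x)
permutations-complete {[]}    ω = _ , here refl , λ x → fixesRest ω λ ()
permutations-complete {x ∷ d} ω =
  let ω₁ , ω₁∈ , ω₀≗ω₁ = permutations-complete ω₀ in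
  compose id there t ω₁ ,
  ∈-concat⁺′ (∈-map⁺ (compose id there t) ω₁∈)
    (∈-mapWith∈⁺ (λ y∈ → map (compose id there (transposition (here refl) y∈)) (permutations d)) y∈) ,
  λ z → trans (sym (transpose-involutive x y (ω · z))) (cong (transpose x y) (ω₀≗ω₁ z))
  where
  y  = ω · x
  y∈ : y ∈ x ∷ d
  y∈ = ·-closed ω (here refl)
  t = transposition (here refl) y∈

  fixes : ∀ {z} → z ∉ d → transpose x y (ω · z) ≡ z
  fixes {z} z∉d with z ≟ x
  ... | yes refl = transpose-right x y
  ... | no  z≢x  = trans (cong (transpose x y) (fixesRest ω z∉)) (transpose-rest z≢x λ { refl → z∉ y∈ })
    where
    z∉ : z ∉ x ∷ d
    z∉ (here z≡x)  = z≢x z≡x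
    z∉ (there z∈d) = z∉d z∈d

  ω₀ : Sym d
  ω₀ = record { extension = extension t ↔-∘ extension ω ; fixesRest = fixes }

increasing⇒Unique : ∀ {d} → AllPairs _<_ d → Unique d
increasing⇒Unique = AllPairs.map ℕ.<⇒≢

-- If the head x of e is not the head y of d, then y lies below x and so below all of e, and can be
-- skipped.
subset⇒⊆ : ∀ {e d} → AllPairs _<_ e → AllPairs _<_ d → (∀ {x} → x ∈ e → x ∈ d) → e ⊆ d
subset⇒⊆ {[]}    {d}     _           _           _   = Sublist.minimum d
subset⇒⊆ {x ∷ e} {[]}    _           _           sub with () ← sub (here refl)
subset⇒⊆ {x ∷ e} {y ∷ d} (x<e ∷ e<) (y<d ∷ d<) sub with sub (here refl)
... | here refl = refl ∷ subset⇒⊆ e< d< λ z∈ → Any.tail (λ { refl → ℕ.<-irrefl refl (All.lookup x<e z∈) }) (sub (there z∈))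
... | there x∈d = y ∷ʳ subset⇒⊆ (x<e ∷ e<) d< λ z∈ → Any.tail (λ { refl → ℕ.<-irrefl refl (y<z z∈) }) (sub z∈)
  where
  y<x = All.lookup y<d x∈d

  y<z : ∀ {z} → z ∈ x ∷ e → y < z
  y<z (here refl) = y<x
  y<z (there z∈)  = ℕ.<-trans y<x (All.lookup x<e z∈)

increasing-≡ : ∀ {d e} → AllPairs _<_ d → AllPairs _<_ e → (∀ {x} → x ∈ d → x ∈ e) → (∀ {x} → x ∈ e → x ∈ d) →
               d ≡ e
increasing-≡ d< e< d⊆e e⊆d = ⊆-antisym (subset⇒⊆ d< e< d⊆e) (subset⇒⊆ e< d< e⊆d)

subsets-unique : ∀ d d< → AllPairs (λ s s′ → proj₁ s ≢ proj₁ s′) (subsets d d<)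
subsets-unique []      []         = [] ∷ []
subsets-unique (x ∷ d) (x<d ∷ d<) = AllPairs.++⁺
  (AllPairs.map⁺ (subsets-unique d d<))
  (AllPairs.map⁺ (AllPairs.map (λ e≢e′ eq → e≢e′ (List.∷-injectiveʳ eq)) (subsets-unique d d<)))
  (All.map⁺ (All.tabulate λ {(e , e⊆d , _)} _ → All.map⁺ (All.tabulate λ _ e≡ →
    ℕ.<-irrefl refl (All.lookup x<d (Sublist.lookup e⊆d (subst (x ∈_) (sym e≡) (here refl)))))))

subsets-complete : ∀ {e d} → e ⊆ d → ∀ d< → ∃ λ s → s ∈ subsets d d< × proj₁ s ≡ e
subsets-complete []          []         = _ , here refl , refl
subsets-complete (y ∷ʳ e⊆d)  (y<d ∷ d<) with s , s∈ , refl ← subsets-complete e⊆d d< =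
  _ , ∈-++⁺ˡ (∈-map⁺ _ s∈) , refl
subsets-complete (refl ∷ e⊆d) (y<d ∷ d<) with s , s∈ , refl ← subsets-complete e⊆d d< =
  _ , ∈-++⁺ʳ (map _ (subsets _ d<)) (∈-map⁺ _ s∈) , refl

supportedOn : ∀ {m} e → AllPairs _<_ e → Dec (All (_∈ e) (upTo m)) → List (PartialPerm m)
supportedOn e e< (yes [m]⊆e) = map (λ ω → record { increasing = e< ; marked = [m]⊆e ; perm = ω }) (permutations e)
supportedOn e e< (no _)      = []

-- As for orbit, the metavariable stands for a local function of partialPermsWithin.
on≡supportedOn : ∀ {m} (p : PartialPerm m) (s : ∃ λ e → e ⊆ domain p × AllPairs _<_ e) →
                 _ ≡ supportedOn (proj₁ s) (proj₂ (proj₂ s)) (All.all? (_∈? proj₁ s) (upTo m))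

partialPermsWithin≡ : ∀ {m} (p : PartialPerm m) → partialPermsWithin p ≡
                      concatMap (λ (e , _ , e<) → supportedOn e e< (All.all? (_∈? e) (upTo m)))
                                (subsets (domain p) (increasing p))
partialPermsWithin≡ p = List.concatMap-cong (on≡supportedOn p) (subsets (domain p) (increasing p))

on≡supportedOn {m} p (e , _ , e<) with All.all? (_∈? e) (upTo m)
... | yes _ = refl
... | no  _ = refl

supportedOn-unique : ∀ {m e} e< (dec : Dec (All (_∈ e) (upTo m))) →
                     AllPairs (λ p q → ¬ p ≈ₚ q) (supportedOn e e< dec)
supportedOn-unique e< (yes _) =
  AllPairs.map⁺ (AllPairs.map (λ ω≉ω′ (_ , eq) → ω≉ω′ eq) (permutations-unique (increasing⇒Unique e<)))
supportedOn-unique e< (no _)  = []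

supportedOn-domain : ∀ {m e} e< (dec : Dec (All (_∈ e) (upTo m))) →
                     All (λ p → domain p ≡ e) (supportedOn e e< dec)
supportedOn-domain e< (yes _) = All.map⁺ (All.tabulate λ _ → refl)
supportedOn-domain e< (no _)  = []

partialPermsWithin-unique : ∀ {m} (p : PartialPerm m) → AllPairs (λ q q′ → ¬ q ≈ₚ q′) (partialPermsWithin p)
partialPermsWithin-unique {m} p = subst (AllPairs _) (sym (partialPermsWithin≡ p)) (AllPairs.concat⁺
  (All.map⁺ (All.tabulate λ {(e , _ , e<)} _ → supportedOn-unique e< (All.all? (_∈? e) (upTo m))))
  (AllPairs.map⁺ (AllPairs.map
    (λ {(e , _ , e<)} {(e′ , _ , e′<)} e≢e′ →
      All.map (λ q≡ → All.map (λ q′≡ (q≡q′ , _) → e≢e′ (trans (sym q≡) (trans q≡q′ q′≡)))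
                              (supportedOn-domain e′< (All.all? (_∈? e′) (upTo m))))
              (supportedOn-domain e< (All.all? (_∈? e) (upTo m))))
    (subsets-unique (domain p) (increasing p)))))

infix 4 _≗ₚ_

-- Agreement on all of ℕ instead of on the domain only. Given equal domains the two are equivalent,
-- and this form can be used at any point when permutations are composed.
_≗ₚ_ : ∀ {m} → PartialPerm m → PartialPerm m → Set
p ≗ₚ q = domain p ≡ domain q × (∀ x → perm p · x ≡ perm q · x)

supportedOn-complete : ∀ {m e} e< (dec : Dec (All (_∈ e) (upTo m))) (q : PartialPerm m) → domain q ≡ e →
                       ∃ λ q′ → q′ ∈ supportedOn e e< dec × q ≗ₚ q′
supportedOn-complete e< (no ¬[m]⊆e) q refl = contradiction (marked q) ¬[m]⊆e
supportedOn-complete e< (yes _)     q refl with ω , ω∈ , eq ← permutations-complete (perm q) =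
  _ , ∈-map⁺ _ ω∈ , refl , eq

partialPermsWithin-complete : ∀ {m} (p q : PartialPerm m) → (∀ {x} → x ∈ domain q → x ∈ domain p) →
                              ∃ λ q′ → q′ ∈ partialPermsWithin p × q ≗ₚ q′
partialPermsWithin-complete {m} p q q⊆p
  with (e , _ , e<) , s∈ , e≡ ← subsets-complete (subset⇒⊆ (increasing q) (increasing p) q⊆p) (increasing p)
  with q′ , q′∈ , q≗q′ ← supportedOn-complete e< (All.all? (_∈? e) (upTo m)) q (sym e≡)
  = q′ , subst (q′ ∈_) (sym (partialPermsWithin≡ p)) (∈-concat⁺′ q′∈ (∈-map⁺ _ s∈)) , q≗q′

-- Sums of indicator functions and structure coefficients

module _ {r ℓ} (R : CommutativeRing r ℓ) where
  open CommutativeRing R using (Carrier; _≈_; 0#; 1#; +-cong; +-assoc; +-identityˡ; +-identityʳ; *-cong;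
    *-congˡ; *-identityˡ; *-identityʳ; zeroˡ; zeroʳ; +-monoid)
    renaming (_+_ to _⊕_; _*_ to _⊛_; refl to ≈-refl; sym to ≈-sym; trans to ≈-trans; reflexive to ≈-reflexive)

  indicator : Bool → Carrier
  indicator b = if b then 1# else 0#

  module _ {a} {X : Set a} where
    sumOver-cong : ∀ (xs : List X) {f g} → (∀ x → f x ≈ g x) → sumOver R xs f ≈ sumOver R xs g
    sumOver-cong []       f≈g = ≈-refl
    sumOver-cong (x ∷ xs) f≈g = +-cong (f≈g x) (sumOver-cong xs f≈g)

    sumOver-≈0 : ∀ {xs : List X} {f} → All (λ x → f x ≈ 0#) xs → sumOver R xs f ≈ 0#
    sumOver-≈0 []       = ≈-refl
    sumOver-≈0 (z ∷ zs) = ≈-trans (+-cong z (sumOver-≈0 zs)) (+-identityˡ 0#)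

    sumOver-++ : ∀ (xs : List X) {ys} f → sumOver R (xs ++ ys) f ≈ sumOver R xs f ⊕ sumOver R ys f
    sumOver-++ []       f = ≈-sym (+-identityˡ _)
    sumOver-++ (x ∷ xs) f = ≈-trans (+-cong ≈-refl (sumOver-++ xs f)) (≈-sym (+-assoc _ _ _))

  sumOver-cartesianProduct : ∀ {X Y : Set} (xs : List X) (ys : List Y) f →
    sumOver R xs (λ x → sumOver R ys (λ y → f (x , y))) ≈ sumOver R (cartesianProduct xs ys) f
  sumOver-cartesianProduct []       ys f = ≈-refl
  sumOver-cartesianProduct (x ∷ xs) ys f = ≈-sym (≈-trans (sumOver-++ (map (x ,_) ys) f)
    (+-cong (≈-reflexive (cong (foldr _⊕_ 0#) (sym (List.map-∘ ys)))) (≈-sym (sumOver-cartesianProduct xs ys f))))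

  sumOver-indicator : ∀ {X : Set} {P : X → Set} (P? : ∀ x → Dec (P x)) xs →
                      sumOver R xs (λ x → indicator (does (P? x))) ≈ fromℤ R (+ length (filter P? xs))
  sumOver-indicator P? []       = ≈-refl
  sumOver-indicator P? (x ∷ xs) with does (P? x)
  ... | true  = +-cong ≈-refl (sumOver-indicator P? xs)
  ... | false = ≈-trans (+-identityˡ _) (sumOver-indicator P? xs)

  indicator-∧ : ∀ a b c → (if a then indicator b ⊛ indicator c else 0#) ≈ indicator (a ∧ b ∧ c)
  indicator-∧ false _     _ = ≈-refl
  indicator-∧ true  false _ = zeroˡ _
  indicator-∧ true  true  c = *-identityˡ _

  -- Each term is 0 or 1, so the convolution is the image in R of a number of factorisations. This
  -- is the source of the integrality of the coefficients, whatever R is.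
  convolution-indicator : ∀ {X : Set} {_≈ˣ_ : X → X → Set} {P Q : X → Set} (_∙_ : X → X → X)
    (_≈?_ : ∀ x y → Dec (x ≈ˣ y)) (factors : X → List X) (P? : ∀ x → Dec (P x)) (Q? : ∀ x → Dec (Q x)) z →
    convolution R _∙_ _≈?_ factors (λ x → indicator (does (P? x))) (λ x → indicator (does (Q? x))) z ≈
    fromℤ R (+ length (filter (λ (x , y) → ((x ∙ y) ≈? z) ×-dec P? x ×-dec Q? y)
                              (cartesianProduct (factors z) (factors z))))
  convolution-indicator _∙_ _≈?_ factors P? Q? z = ≈-trans
    (sumOver-cong (factors z) λ x → sumOver-cong (factors z) λ y →
      indicator-∧ (does ((x ∙ y) ≈? z)) (does (P? x)) (does (Q? y)))
    (≈-trans (sumOver-cartesianProduct (factors z) (factors z) _)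
             (sumOver-indicator (λ (x , y) → ((x ∙ y) ≈? z) ×-dec P? x ×-dec Q? y)
               (cartesianProduct (factors z) (factors z))))

  module _ {I : Setoid 0ℓ 0ℓ} {X : Set} {_*_ : FormalSum R X → FormalSum R X → FormalSum R X}
           {P : Setoid.Carrier I → X → Set} (P? : ∀ i x → Dec (P i x))
           (s : StructureCoefficients R I _*_ (λ i x → indicator (does (P? i x)))) where
    open Setoid I using () renaming (Carrier to Index; _≈_ to _≈ᴵ_; sym to ≈ᴵ-sym; trans to ≈ᴵ-trans)

    private
      b : Index → FormalSum R X
      b i x = indicator (does (P? i x))

    -- The expansion is evaluated at an element x of class k. The classes are disjoint, so at most
    -- one listed index contributes, and it does so with basis value 1.
    coeff-value : (∀ {i i′ x} → P i x → P i′ x → i ≈ᴵ i′) → (∀ {i i′ x} → i ≈ᴵ i′ → P i x → P i′ x) →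
                  ∀ i j {k x} → P k x → coeff s i j k ≈ (b i * b j) x
    coeff-value P-unique P-resp i j {k} {x} Pkx with is , is! , support , expand ← expansion s i j x =
      ≈-sym (≈-trans expand ([ single is! , vanishing is ]′ (support k)))
      where
      term : Index → Carrier
      term l = coeff s i j l ⊛ b l x

      term-≈ : ∀ {l} → P l x → term l ≈ coeff s i j k
      term-≈ {l} Plx = ≈-trans (*-congˡ (≈-reflexive (cong indicator (dec-true (P? l x) Plx))))
        (≈-trans (*-identityʳ _) (coeff-cong s (Setoid.refl I) (Setoid.refl I) (P-unique Plx Pkx)))

      term-≈0 : ∀ {l} → ¬ P l x → term l ≈ 0#
      term-≈0 {l} ¬Plx = ≈-trans (*-congˡ (≈-reflexive (cong indicator (dec-false (P? l x) ¬Plx)))) (zeroʳ _)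

      -- If k is only known to have a zero term, its coefficient is itself zero, since the basis
      -- element takes the value 1 at x. Every listed term then vanishes, including any whose index
      -- is equivalent to k.
      vanishing : ∀ ls → term k ≈ 0# → sumOver R ls term ≈ coeff s i j k
      vanishing ls k≈0 = ≈-trans (sumOver-≈0 (All.universal zero′ ls)) (≈-sym c≈0)
        where
        c≈0 : coeff s i j k ≈ 0#
        c≈0 = ≈-trans (≈-sym (term-≈ Pkx)) k≈0

        zero′ : ∀ l → term l ≈ 0#
        zero′ l = decide (P? l x)
          where
          decide : Dec (P l x) → term l ≈ 0#
          decide (yes Plx) = ≈-trans (term-≈ Plx) c≈0
          decide (no ¬Plx) = term-≈0 ¬Plx

      single : ∀ {ls} → AllPairs (λ l l′ → ¬ l ≈ᴵ l′) ls → Any.Any (k ≈ᴵ_) ls → sumOver R ls term ≈ coeff s i j k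
      single (l≉ ∷ _) (here k≈l) = ≈-trans
        (+-cong (term-≈ (P-resp k≈l Pkx))
          (sumOver-≈0 (All.map (λ l≉l′ → term-≈0 λ Pl′x → l≉l′ (≈ᴵ-trans (≈ᴵ-sym k≈l) (P-unique Pkx Pl′x))) l≉)))
        (+-identityʳ _)
      single {l ∷ ls} (l≉ ∷ u) (there k∈) = ≈-trans
        (+-cong (term-≈0 λ Plx → let l≉l′ , k≈l′ = All.lookupAny l≉ k∈ in l≉l′ (≈ᴵ-trans (P-unique Plx Pkx) k≈l′))
                (single u k∈))
        (+-identityˡ _)

-- Factorisations of partial permutations and of permutations

≈ₛ⇒≗ : ∀ {d} {ω ω′ : Sym d} → ω ≈ₛ ω′ → ∀ x → ω · x ≡ ω′ · x
≈ₛ⇒≗ {d} {ω} {ω′} eq x with x ∈? d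
... | yes x∈ = All.lookup eq x∈
... | no  x∉ = trans (fixesRest ω x∉) (sym (fixesRest ω′ x∉))

≗⇒≈ₛ : ∀ {d d′} (ω : Sym d) (ω′ : Sym d′) → (∀ x → ω · x ≡ ω′ · x) → ω ≈ₛ ω′
≗⇒≈ₛ ω ω′ eq = All.tabulate λ {x} _ → eq x

≗-type : ∀ {m d} (ω ω′ : Sym d) (ρ : Shape m) → Unique d → (∀ x → ω · x ≡ ω′ · x) → HasType ω ρ → HasType ω′ ρ
≗-type ω ω′ ρ d! eq t = ↭ᶜ-trans (markedCycles-extend ω ω′ d! d! [] eq [] (λ ()) id id) t

symSetoid : List ℕ → Setoid _ _
symSetoid d = record
  { Carrier       = Sym d
  ; _≈_           = _≈ₛ_
  ; isEquivalence = record
    { refl  = λ {ω} → ≗⇒≈ₛ ω ω λ _ → refl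
    ; sym   = All.map sym
    ; trans = λ p q → All.zipWith (λ (a , b) → trans a b) (p , q)
    }
  }

≈ₚ⇒≗ₚ : ∀ {m} {p q : PartialPerm m} → p ≈ₚ q → p ≗ₚ q
≈ₚ⇒≗ₚ {p = p} {q} (d≡ , eq) = d≡ , values
  where
  values : ∀ x → perm p · x ≡ perm q · x
  values x with x ∈? domain p
  ... | yes x∈ = All.lookup eq x∈
  ... | no  x∉ = trans (fixesRest (perm p) x∉) (sym (fixesRest (perm q) (x∉ ∘ subst (x ∈_) (sym d≡))))

≗ₚ⇒≈ₚ : ∀ {m} {p q : PartialPerm m} → p ≗ₚ q → p ≈ₚ q
≗ₚ⇒≈ₚ {p = p} {q} (d≡ , eq) = d≡ , ≗⇒≈ₛ (perm p) (perm q) eq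

≗ₚ-type : ∀ {m} (p q : PartialPerm m) (ρ : Shape m) → p ≗ₚ q → HasType (perm p) ρ → HasType (perm q) ρ
≗ₚ-type p q ρ (d≡ , eq) t = ↭ᶜ-trans (markedCycles-extend (perm p) (perm q) (increasing⇒Unique (increasing p))
  (increasing⇒Unique (increasing q)) [] eq [] (λ ()) (subst (_ ∈_) d≡) (subst (_ ∈_) (sym d≡))) t

≗ₚ-sym : ∀ {m} {p q : PartialPerm m} → p ≗ₚ q → q ≗ₚ p
≗ₚ-sym (d≡ , eq) = sym d≡ , λ x → sym (eq x)

≗ₚ-trans : ∀ {m} {p q s : PartialPerm m} → p ≗ₚ q → q ≗ₚ s → p ≗ₚ s
≗ₚ-trans (d≡ , eq) (d≡′ , eq′) = trans d≡ d≡′ , λ x → trans (eq x) (eq′ x)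

partialPermSetoid : ℕ → Setoid _ _
partialPermSetoid m = record
  { Carrier       = PartialPerm m
  ; _≈_           = _≈ₚ_
  ; isEquivalence = record
    { refl  = λ {p} → ≗ₚ⇒≈ₚ {p = p} {p} (refl , λ _ → refl)
    ; sym   = λ {p} {q} eq → ≗ₚ⇒≈ₚ {p = q} {p} (≗ₚ-sym {p = p} {q} (≈ₚ⇒≗ₚ {p = p} {q} eq))
    ; trans = λ {p} {q} {s} eq eq′ → ≗ₚ⇒≈ₚ {p = p} {s}
                (≗ₚ-trans {p = p} {q} {s} (≈ₚ⇒≗ₚ {p = p} {q} eq) (≈ₚ⇒≗ₚ {p = q} {s} eq′))
    }
  }

-- Equivalent to `(p ∙ₚ q) ≈ₚ x`, but in terms of membership and values, so that transport and
-- conjugation need not handle the sorted list representing the union.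
record IsProduct {m} (p q x : PartialPerm m) : Set where
  field
    left⊆   : ∀ {y} → y ∈ domain p → y ∈ domain x
    right⊆  : ∀ {y} → y ∈ domain q → y ∈ domain x
    covered : ∀ {y} → y ∈ domain x → y ∈ domain p ⊎ y ∈ domain q
    values  : ∀ y → perm p · (perm q · y) ≡ perm x · y

open IsProduct public

∈-∪⁻ : ∀ {x} d e → x ∈ d ∪ e → x ∈ d ⊎ x ∈ e
∈-∪⁻ d e x∈ = ∈-++⁻ d (proj₂ (∈-filter⁻ (_∈? (d ++ e)) {xs = upTo _} x∈))

IsProduct⇒≈ₚ : ∀ {m} (p q x : PartialPerm m) → IsProduct p q x → (p ∙ₚ q) ≈ₚ x
IsProduct⇒≈ₚ p q x prod = ≗ₚ⇒≈ₚ {p = p ∙ₚ q} {x}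
  ( increasing-≡ (∪-increasing (domain p) (domain q)) (increasing x)
      (λ y∈ → [ left⊆ prod , right⊆ prod ]′ (∈-∪⁻ (domain p) (domain q) y∈))
      (λ y∈ → [ ∈-∪⁺ˡ (domain p) (domain q) , ∈-∪⁺ʳ (domain p) (domain q) ]′ (covered prod y∈))
  , values prod )

≈ₚ⇒IsProduct : ∀ {m} (p q x : PartialPerm m) → (p ∙ₚ q) ≈ₚ x → IsProduct p q x
≈ₚ⇒IsProduct p q x eq with d≡ , vals ← ≈ₚ⇒≗ₚ {p = p ∙ₚ q} {x} eq = record
  { left⊆   = λ y∈ → subst (_ ∈_) d≡ (∈-∪⁺ˡ (domain p) (domain q) y∈)
  ; right⊆  = λ y∈ → subst (_ ∈_) d≡ (∈-∪⁺ʳ (domain p) (domain q) y∈)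
  ; covered = λ y∈ → ∈-∪⁻ (domain p) (domain q) (subst (_ ∈_) (sym d≡) y∈)
  ; values  = vals
  }

IsProduct-resp : ∀ {m} {p p′ q q′ x : PartialPerm m} → p ≗ₚ p′ → q ≗ₚ q′ → IsProduct p q x → IsProduct p′ q′ x
IsProduct-resp {p = p} {p′} {q} {q′} {x} (dp , ep) (dq , eq) prod = record
  { left⊆   = left⊆ prod ∘ subst (_ ∈_) (sym dp)
  ; right⊆  = right⊆ prod ∘ subst (_ ∈_) (sym dq)
  ; covered = λ y∈ → [ inj₁ ∘ subst (_ ∈_) dp , inj₂ ∘ subst (_ ∈_) dq ]′ (covered prod y∈)
  ; values  = λ y → trans (sym (trans (ep _) (cong (perm p′ ·_) (eq y)))) (values prod y)
  }

module _ {m : ℕ} (λ′ δ : Shape m) where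
  factorisations : PartialPerm m → List (PartialPerm m × PartialPerm m)
  factorisations x = filter (λ (p , q) → ((p ∙ₚ q) ≈ₚ? x) ×-dec hasType? (perm p) λ′ ×-dec hasType? (perm q) δ)
                            (cartesianProduct (partialPermsWithin x) (partialPermsWithin x))

  IsFactorisation : PartialPerm m → PartialPerm m × PartialPerm m → Set
  IsFactorisation x (p , q) = IsProduct p q x × HasType (perm p) λ′ × HasType (perm q) δ

  _≈ₚₚ_ : PartialPerm m × PartialPerm m → PartialPerm m × PartialPerm m → Set
  (p , q) ≈ₚₚ (p′ , q′) = p ≈ₚ p′ × q ≈ₚ q′

  _≗ₚₚ_ : PartialPerm m × PartialPerm m → PartialPerm m × PartialPerm m → Set
  (p , q) ≗ₚₚ (p′ , q′) = p ≗ₚ p′ × q ≗ₚ q′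

  factorisations-unique : ∀ x → AllPairs (λ f f′ → ¬ f ≈ₚₚ f′) (factorisations x)
  factorisations-unique x = AllPairs.filter⁺ _ (SetoidUnique.cartesianProduct⁺ (partialPermSetoid m) (partialPermSetoid m)
    (partialPermsWithin-unique x) (partialPermsWithin-unique x))

  factorisations-sound : ∀ {x f} → f ∈ factorisations x → IsFactorisation x f
  factorisations-sound {x} {p , q} f∈
    with _ , p∙q≈x , tp , tq ← ∈-filter⁻ _ {xs = cartesianProduct (partialPermsWithin x) (partialPermsWithin x)} f∈
    = ≈ₚ⇒IsProduct p q x p∙q≈x , tp , tq

  factorisations-complete : ∀ {x f} → IsFactorisation x f → ∃ λ f′ → f′ ∈ factorisations x × f ≗ₚₚ f′
  factorisations-complete {x} {p , q} (prod , tp , tq)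
    with p′ , p′∈ , p≗ ← partialPermsWithin-complete x p (left⊆ prod)
       | q′ , q′∈ , q≗ ← partialPermsWithin-complete x q (right⊆ prod)
    = (p′ , q′) , ∈-filter⁺ _ (∈-cartesianProduct⁺ p′∈ q′∈)
        ( IsProduct⇒≈ₚ p′ q′ x (IsProduct-resp {p = p} {p′} {q} {q′} p≗ q≗ prod)
        , ≗ₚ-type p p′ λ′ p≗ tp , ≗ₚ-type q q′ δ q≗ tq)
      , p≗ , q≗

module _ {m n : ℕ} (λ′ δ : Shape m) where
  groupFactorisations : Sym (upTo n) → List (Sym (upTo n) × Sym (upTo n))
  groupFactorisations ω = filter (λ (σ , τ) → ((σ ∘ₛ τ) ≈ₛ? ω) ×-dec hasType? σ λ′ ×-dec hasType? τ δ)
                                 (cartesianProduct (permutations (upTo n)) (permutations (upTo n)))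

  IsGroupFactorisation : Sym (upTo n) → Sym (upTo n) × Sym (upTo n) → Set
  IsGroupFactorisation ω (σ , τ) = (∀ x → σ · (τ · x) ≡ ω · x) × HasType σ λ′ × HasType τ δ

  _≈ₛₛ_ : Sym (upTo n) × Sym (upTo n) → Sym (upTo n) × Sym (upTo n) → Set
  (σ , τ) ≈ₛₛ (σ′ , τ′) = σ ≈ₛ σ′ × τ ≈ₛ τ′

  _≗ₛₛ_ : Sym (upTo n) × Sym (upTo n) → Sym (upTo n) × Sym (upTo n) → Set
  (σ , τ) ≗ₛₛ (σ′ , τ′) = (∀ x → σ · x ≡ σ′ · x) × (∀ x → τ · x ≡ τ′ · x)

  groupFactorisations-unique : ∀ ω → AllPairs (λ f f′ → ¬ f ≈ₛₛ f′) (groupFactorisations ω)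
  groupFactorisations-unique ω = AllPairs.filter⁺ _ (SetoidUnique.cartesianProduct⁺ (symSetoid (upTo n)) (symSetoid (upTo n))
    (permutations-unique (Unique.upTo⁺ n)) (permutations-unique (Unique.upTo⁺ n)))

  groupFactorisations-sound : ∀ {ω f} → f ∈ groupFactorisations ω → IsGroupFactorisation ω f
  groupFactorisations-sound {ω} {σ , τ} f∈
    with _ , στ≈ω , tσ , tτ ← ∈-filter⁻ _ {xs = cartesianProduct (permutations (upTo n)) (permutations (upTo n))} f∈
    = ≈ₛ⇒≗ {ω = σ ∘ₛ τ} {ω} στ≈ω , tσ , tτ

  groupFactorisations-complete : ∀ {ω f} → IsGroupFactorisation ω f → ∃ λ f′ → f′ ∈ groupFactorisations ω × f ≗ₛₛ f′
  groupFactorisations-complete {ω} {σ , τ} (prod , tσ , tτ)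
    with σ′ , σ′∈ , σ≗ ← permutations-complete σ | τ′ , τ′∈ , τ≗ ← permutations-complete τ
    = (σ′ , τ′) , ∈-filter⁺ _ (∈-cartesianProduct⁺ σ′∈ τ′∈)
        ( ≗⇒≈ₛ (σ′ ∘ₛ τ′) ω (λ x → trans (sym (trans (σ≗ _) (cong (σ′ ·_) (τ≗ x)))) (prod x))
        , ≗-type σ σ′ λ′ (Unique.upTo⁺ n) σ≗ tσ , ≗-type τ τ′ δ (Unique.upTo⁺ n) τ≗ tτ)
      , σ≗ , τ≗

-- Conjugation invariance

record Conjugates {m} (π : ℕ ↔ ℕ) (p p′ : PartialPerm m) : Set where
  field
    image    : ∀ {y} → y ∈ domain p → Inverse.to π y ∈ domain p′
    preimage : ∀ {y} → y ∈ domain p′ → Inverse.from π y ∈ domain p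
    commutes : ∀ y → perm p′ · Inverse.to π y ≡ Inverse.to π (perm p · y)

open Conjugates public

Conjugates-sym : ∀ {m π} {p p′ : PartialPerm m} → Conjugates π p p′ → Conjugates (↔-sym π) p′ p
Conjugates-sym {π = π} {p} {p′} c = record
  { image    = preimage c
  ; preimage = image c
  ; commutes = λ y → ↔-injective π (begin
      to (perm p · from y)   ≡⟨ commutes c (from y) ⟨
      perm p′ · to (from y)  ≡⟨ cong (perm p′ ·_) (strictlyInverseˡ y) ⟩
      perm p′ · y            ≡⟨ strictlyInverseˡ _ ⟨
      to (from (perm p′ · y)) ∎)
  }
  where
  open ≡-Reasoning
  open Inverse π using (to; from; strictlyInverseˡ)

Conjugates-injective : ∀ {m π} {p q s : PartialPerm m} → Conjugates π p s → Conjugates π q s → p ≗ₚ q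
Conjugates-injective {π = π} {p} {q} c c′ =
  increasing-≡ (increasing p) (increasing q)
    (λ y∈ → subst (_∈ domain q) (Inverse.strictlyInverseʳ π _) (preimage c′ (image c y∈)))
    (λ y∈ → subst (_∈ domain p) (Inverse.strictlyInverseʳ π _) (preimage c (image c′ y∈))) ,
  λ y → ↔-injective π (trans (sym (commutes c y)) (commutes c′ y))

Conjugates-≗ : ∀ {m π} {p q q′ : PartialPerm m} → q ≗ₚ q′ → Conjugates π p q → Conjugates π p q′
Conjugates-≗ {π = π} (d≡ , eq) c = record
  { image    = subst (_ ∈_) d≡ ∘ image c
  ; preimage = preimage c ∘ subst (_ ∈_) (sym d≡)
  ; commutes = λ y → trans (sym (eq (Inverse.to π y))) (commutes c y)
  }

Conjugates-type : ∀ {m π} {p p′ : PartialPerm m} (ρ : Shape m) → (∀ {i} → i < m → Inverse.to π i ≡ i) →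
                  Conjugates π p p′ → HasType (perm p) ρ → HasType (perm p′) ρ
Conjugates-type {π = π} {p} {p′} ρ fixes c t = ↭ᶜ-trans
  (markedCycles-conjugate (perm p) (perm p′) π (increasing⇒Unique (increasing p)) (increasing⇒Unique (increasing p′))
    fixes (commutes c) (image c) (preimage c)) t

Conjugates-product : ∀ {m π} {p p′ q q′ x x′ : PartialPerm m} → Conjugates π p p′ → Conjugates π q q′ →
                     Conjugates π x x′ → IsProduct p q x → IsProduct p′ q′ x′
Conjugates-product {π = π} {p} {p′} {q} {q′} {x} {x′} cp cq cx prod = record
  { left⊆   = λ y∈ → subst (_∈ domain x′) (strictlyInverseˡ _) (image cx (left⊆ prod (preimage cp y∈)))
  ; right⊆  = λ y∈ → subst (_∈ domain x′) (strictlyInverseˡ _) (image cx (right⊆ prod (preimage cq y∈)))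
  ; covered = λ y∈ → [ (λ y∈p → inj₁ (subst (_∈ domain p′) (strictlyInverseˡ _) (image cp y∈p)))
                     , (λ y∈q → inj₂ (subst (_∈ domain q′) (strictlyInverseˡ _) (image cq y∈q)))
                     ]′ (covered prod (preimage cx y∈))
  ; values  = λ y → subst (λ z → perm p′ · (perm q′ · z) ≡ perm x′ · z) (strictlyInverseˡ y) (begin
      perm p′ · (perm q′ · to (from y))  ≡⟨ cong (perm p′ ·_) (commutes cq (from y)) ⟩
      perm p′ · to (perm q · from y)     ≡⟨ commutes cp _ ⟩
      to (perm p · (perm q · from y))    ≡⟨ cong to (values prod (from y)) ⟩
      to (perm x · from y)               ≡⟨ commutes cx (from y) ⟨
      perm x′ · to (from y)              ∎)
  }
  where
  open ≡-Reasoning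
  open Inverse π using (to; from; strictlyInverseˡ)

module _ {m} (π : ℕ ↔ ℕ) (fixes : ∀ {i} → i < m → Inverse.to π i ≡ i) {x x′ : PartialPerm m}
         (cx : Conjugates π x x′) where
  open Inverse π using (to; from; strictlyInverseˡ; strictlyInverseʳ)

  -- The domain is selected from `domain x′` instead of being mapped by `π`, which would destroy the
  -- increasing order. No point is lost because `π` carries `domain x`, and with it `domain p`, into
  -- `domain x′`.
  conjugate : (p : PartialPerm m) → (∀ {y} → y ∈ domain p → y ∈ domain x) → PartialPerm m
  conjugate p p⊆x = record
    { domain     = filter (λ y → from y ∈? domain p) (domain x′)
    ; increasing = AllPairs.filter⁺ _ (increasing x′)
    ; marked     = All.tabulate λ {i} i∈ → ∈-filter⁺ _ (All.lookup (marked x′) i∈)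
                     (subst (_∈ domain p) (trans (sym (strictlyInverseʳ i)) (cong from (fixes (∈-upTo⁻ i∈))))
                       (All.lookup (marked p) i∈))
    ; perm       = record
      { extension = π ↔-∘ (extension (perm p) ↔-∘ ↔-sym π)
      ; fixesRest = λ {y} y∉ → trans (cong to (fixesRest (perm p) λ y∈ → y∉ (∈-filter⁺ (λ y → from y ∈? domain p)
                      (subst (_∈ domain x′) (strictlyInverseˡ y) (image cx (p⊆x y∈))) y∈))) (strictlyInverseˡ y)
      }
    }

  conjugate-Conjugates : ∀ p (p⊆x : ∀ {y} → y ∈ domain p → y ∈ domain x) → Conjugates π p (conjugate p p⊆x)
  conjugate-Conjugates p p⊆x = record
    { image    = λ y∈ → ∈-filter⁺ (λ y → from y ∈? domain p) (image cx (p⊆x y∈))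
                          (subst (_∈ domain p) (sym (strictlyInverseʳ _)) y∈)
    ; preimage = λ y∈ → proj₂ (∈-filter⁻ (λ y → from y ∈? domain p) {xs = domain x′} y∈)
    ; commutes = λ y → cong (λ z → to (perm p · z)) (strictlyInverseʳ y)
    }

  factorisations-conjugate-≤ : ∀ (λ′ δ : Shape m) → length (factorisations λ′ δ x) ≤ length (factorisations λ′ δ x′)
  factorisations-conjugate-≤ λ′ δ = count-≤ {_≈_ = _≈ₚₚ_ λ′ δ}
    (λ (p , q) (p′ , q′) → Conjugates π p p′ × Conjugates π q q′)
    (λ {(p , q)} {(p′ , q′)} {(s , t)} (cp , cq) (cp′ , cq′) →
      ≗ₚ⇒≈ₚ {p = p} {p′} (Conjugates-injective {p = p} {p′} {s} cp cp′) ,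
      ≗ₚ⇒≈ₚ {p = q} {q′} (Conjugates-injective {p = q} {q′} {t} cq cq′))
    (factorisations-unique λ′ δ x) transport
    where
    transport : ∀ {f} → f ∈ factorisations λ′ δ x → ∃ λ f′ → f′ ∈ factorisations λ′ δ x′ ×
                Conjugates π (proj₁ f) (proj₁ f′) × Conjugates π (proj₂ f) (proj₂ f′)
    transport {p , q} f∈
      with prod , tp , tq ← factorisations-sound λ′ δ {x} f∈
      with cp ← conjugate-Conjugates p (left⊆ prod) | cq ← conjugate-Conjugates q (right⊆ prod)
      with (p′ , q′) , f′∈ , p≗ , q≗ ← factorisations-complete λ′ δ {x′}
             ( Conjugates-product {p = p} {_} {q} {_} {x} {x′} cp cq cx prod
             , Conjugates-type {p = p} λ′ fixes cp tp , Conjugates-type {p = q} δ fixes cq tq)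
      = (p′ , q′) , f′∈ ,
        Conjugates-≗ {p = p} {conjugate p (left⊆ prod)} {p′} p≗ cp ,
        Conjugates-≗ {p = q} {conjugate q (right⊆ prod)} {q′} q≗ cq

-- Conjugating both factors maps factorisations of x injectively to those of `x′`; the inverse of
-- `π` gives the opposite inequality.
factorisations-conjugate : ∀ {m π} {x x′ : PartialPerm m} (λ′ δ : Shape m) →
                           (∀ {i} → i < m → Inverse.to π i ≡ i) → Conjugates π x x′ →
                           length (factorisations λ′ δ x) ≡ length (factorisations λ′ δ x′)
factorisations-conjugate {π = π} {x} {x′} λ′ δ fixes c = ℕ.≤-antisym
  (factorisations-conjugate-≤ π fixes {x} {x′} c λ′ δ)
  (factorisations-conjugate-≤ (↔-sym π) (λ i<m → ↔-injective π (trans (Inverse.strictlyInverseˡ π _) (sym (fixes i<m))))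
    {x′} {x} (Conjugates-sym {p = x} {x′} c) λ′ δ)

-- The permutation matching the tails is corrected by the transposition of `πx` and y. The entries
-- already matched differ from `πx` by injectivity and from y by uniqueness, so they stay in place.
matching : ∀ {xs ys : List ℕ} → Unique xs → Unique ys → length xs ≡ length ys →
           Σ[ π ∈ ℕ ↔ ℕ ] map (Inverse.to π) xs ≡ ys
matching {[]}     {[]}     _          _          _  = ↔-id ℕ , refl
matching {x ∷ xs} {y ∷ ys} (x≢ ∷ xs!) (y≢ ∷ ys!) eq with π , refl ← matching xs! ys! (ℕ.suc-injective eq) =
  extension (transposition {d = πx ∷ y ∷ []} (here refl) (there (here refl))) ↔-∘ π ,
  cong₂ _∷_ (transpose-left πx y) (List.map-cong-local (All.tabulate λ {z} z∈ →
    transpose-rest (λ πz≡πx → All.lookup x≢ z∈ (sym (↔-injective π πz≡πx)))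
                   (λ πz≡y → All.lookup y≢ (∈-map⁺ (Inverse.to π) z∈) (sym πz≡y))))
  where
  πx = Inverse.to π x

-- Binomial sums over subsets

sum-applyUpTo-+ : ∀ f g L → sum (applyUpTo (λ j → f j + g j) L) ≡ sum (applyUpTo f L) + sum (applyUpTo g L)
sum-applyUpTo-+ f g zero    = refl
sum-applyUpTo-+ f g (suc L) = trans (cong (λ n → (f 0 + g 0) + n) (sum-applyUpTo-+ (f ∘ suc) (g ∘ suc) L))
  (interchange (f 0) (g 0) _ _)
  where open import Algebra.Properties.CommutativeSemigroup ℕ.+-commutativeSemigroup using (interchange)

sum-applyUpTo-cong : ∀ {f g : ℕ → ℕ} → (∀ j → f j ≡ g j) → ∀ L → sum (applyUpTo f L) ≡ sum (applyUpTo g L)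
sum-applyUpTo-cong f≗g zero    = refl
sum-applyUpTo-cong f≗g (suc L) = cong₂ _+_ (f≗g 0) (sum-applyUpTo-cong (f≗g ∘ suc) L)

sum-applyUpTo-0 : ∀ {f : ℕ → ℕ} → (∀ j → f j ≡ 0) → ∀ L → sum (applyUpTo f L) ≡ 0
sum-applyUpTo-0 f≡0 zero    = refl
sum-applyUpTo-0 f≡0 (suc L) = cong₂ _+_ (f≡0 0) (sum-applyUpTo-0 (f≡0 ∘ suc) L)

nC0≡1 : ∀ n → n C 0 ≡ 1
nC0≡1 n = trans (Comb.nCk≡nC[n∸k] {n = n} z≤n) (Comb.nCn≡1 n)

-- Pascal's rule matches the split into subsets without x and with x, the latter weighted by
-- `κ ∘ suc`; hence the induction is for all `κ`. The bound L is free because the two halves call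
-- for the bounds `suc L` and `L`, and the terms beyond `length d` vanish.
binomialSum≡subsetSum : ∀ (κ : ℕ → ℕ) d (d< : AllPairs _<_ d) L → length d < L →
                        sum (applyUpTo (λ j → κ j ℕ.* (length d C j)) L) ≡
                        sum (map (κ ∘ length ∘ proj₁) (subsets d d<))
binomialSum≡subsetSum κ [] [] (suc L) _ = cong₂ _+_ (ℕ.*-identityʳ (κ 0))
  (sum-applyUpTo-0 (λ j → trans (cong (κ (suc j) ℕ.*_) (Comb.k>n⇒nCk≡0 {0} {suc j} (s≤s z≤n)))
                                (ℕ.*-zeroʳ (κ (suc j)))) L)
binomialSum≡subsetSum κ (x ∷ d) (x<d ∷ d<) (suc L) (s≤s |d|<L) = begin
  κ 0 ℕ.* (suc M C 0) + sum (applyUpTo (λ j → κ (suc j) ℕ.* (suc M C suc j)) L)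
    ≡⟨ cong₂ _+_ (cong (κ 0 ℕ.*_) (trans (nC0≡1 (suc M)) (sym (nC0≡1 M))))
         (trans (sum-applyUpTo-cong pascal L) (sum-applyUpTo-+ _ _ L)) ⟩
  κ 0 ℕ.* (M C 0) + (sum (applyUpTo (λ j → κ (suc j) ℕ.* (M C j)) L) +
                     sum (applyUpTo (λ j → κ (suc j) ℕ.* (M C suc j)) L))
    ≡⟨ x∙yz≈xz∙y (κ 0 ℕ.* (M C 0)) _ _ ⟩
  sum (applyUpTo (λ j → κ j ℕ.* (M C j)) (suc L)) + sum (applyUpTo (λ j → κ (suc j) ℕ.* (M C j)) L)
    ≡⟨ cong₂ _+_ (binomialSum≡subsetSum κ d d< (suc L) (ℕ.m<n⇒m<1+n |d|<L))
                 (binomialSum≡subsetSum (κ ∘ suc) d d< L |d|<L) ⟩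
  sum (map (κ ∘ length ∘ proj₁) ss) + sum (map (κ ∘ suc ∘ length ∘ proj₁) ss)
    ≡⟨ cong₂ (λ us vs → sum us + sum vs) (List.map-∘ ss) (List.map-∘ ss) ⟩
  sum (map (κ ∘ length ∘ proj₁) (map without ss)) + sum (map (κ ∘ length ∘ proj₁) (map with′ ss))
    ≡⟨ sum-++ (map (κ ∘ length ∘ proj₁) (map without ss)) _ ⟨
  sum (map (κ ∘ length ∘ proj₁) (map without ss) ++ map (κ ∘ length ∘ proj₁) (map with′ ss))
    ≡⟨ cong sum (List.map-++ (κ ∘ length ∘ proj₁) (map without ss) (map with′ ss)) ⟨
  sum (map (κ ∘ length ∘ proj₁) (subsets (x ∷ d) (x<d ∷ d<))) ∎
  where
  open ≡-Reasoning
  open import Algebra.Properties.CommutativeSemigroup ℕ.+-commutativeSemigroup using (x∙yz≈xz∙y)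
  M  = length d
  ss = subsets d d<

  Subset : List ℕ → Set
  Subset e′ = ∃ λ e → e ⊆ e′ × AllPairs _<_ e

  without with′ : Subset d → Subset (x ∷ d)
  without (e , e⊆d , e<) = e , x ∷ʳ e⊆d , e<
  with′ (e , e⊆d , e<) = x ∷ e , refl ∷ e⊆d , All-resp-⊆ e⊆d x<d ∷ e<

  pascal : ∀ j → κ (suc j) ℕ.* (suc M C suc j) ≡ κ (suc j) ℕ.* (M C j) + κ (suc j) ℕ.* (M C suc j)
  pascal j = trans (cong (κ (suc j) ℕ.*_) (sym (Comb.nCk+nC[k+1]≡[n+1]C[k+1] M j)))
                   (ℕ.*-distribˡ-+ (κ (suc j)) (M C j) (M C suc j))

sumOver-ℤ : ∀ (f g : ℕ → ℕ) js →
            sumOver +-*-commutativeRing js (λ j → + f j * + g j) ≡ + sum (map (λ j → f j ℕ.* g j) js)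
sumOver-ℤ f g []       = refl
sumOver-ℤ f g (j ∷ js) = trans (cong₂ ℤ._+_ (sym (ℤ.pos-* (f j) (g j))) (sumOver-ℤ f g js))
                               (sym (ℤ.pos-+ (f j ℕ.* g j) _))

fromℤ-ℤ : ∀ n → fromℤ +-*-commutativeRing (+ n) ≡ + n
fromℤ-ℤ zero    = refl
fromℤ-ℤ (suc n) = cong (ℤ._+_ (+ 1)) (fromℤ-ℤ n)

-- Restricting and completing permutations

module _ {m n} (σ : Sym (upTo n)) (p : PartialPerm m) (m≤n : m ≤ n)
         (p⊆n : ∀ {x} → x ∈ domain p → x ∈ upTo n) (p≗σ : ∀ x → perm p · x ≡ σ · x) where
  private
    outside? : ∀ x → Dec (x ∉ domain p)
    outside? x = ¬? (x ∈? domain p)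

    F : List ℕ
    F = filter outside? (upTo n)

    p! : Unique (domain p)
    p! = increasing⇒Unique (increasing p)

    ∈F⁻ : ∀ {x} → x ∈ F → x ∈ upTo n × x ∉ domain p
    ∈F⁻ x∈ = ∈-filter⁻ outside? {xs = upTo n} x∈

    extended : markedCycles m σ ↭ᶜ replicate (length F) (∗ ∷ []) ++ markedCycles m (perm p)
    extended = markedCycles-extend (perm p) σ p! (Unique.upTo⁺ n) (Unique.filter⁺ outside? (Unique.upTo⁺ n)) p≗σ
      (All.tabulate λ x∈ → ℕ.≮⇒≥ λ x<m → proj₂ (∈F⁻ x∈) (All.lookup (marked p) (∈-upTo⁺ x<m)))
      (proj₂ ∘ ∈F⁻)
      (λ x∈ → [ proj₁ ∘ ∈F⁻ , p⊆n ]′ (∈-++⁻ F x∈))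
      decide
      where
      decide : ∀ {x} → x ∈ upTo n → x ∈ F ++ domain p
      decide {x} x∈ with x ∈? domain p
      ... | yes x∈p = ∈-++⁺ʳ F x∈p
      ... | no  x∉p = ∈-++⁺ˡ (∈-filter⁺ outside? x∈ x∉p)

  -- Passing from p to `σ` adds one cycle (∗) for each point of F. Their number is forced by
  -- counting stars, of which `σ` has n - m in all.
  completion-type : (λ′ : Shape m) → HasType (perm p) λ′ → HasType σ (λ′ ^ (n ∸ size λ′))
  completion-type λ′ t = subst (λ k → markedCycles m σ ↭ᶜ replicate k (∗ ∷ []) ++ cycles λ′) |F|≡
    (↭ᶜ-trans extended (↭ₛ.++⁺ˡ (rotationSetoid _) (replicate (length F) (∗ ∷ [])) t))
    where
    open ≡-Reasoning
    |F|≡ : length F ≡ n ∸ size λ′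
    |F|≡ = begin
      length F                                                        ≡⟨ ℕ.m+n∸n≡m (length F) (stars (cycles λ′)) ⟨
      (length F + stars (cycles λ′)) ∸ stars (cycles λ′)              ≡⟨ cong (_∸ stars (cycles λ′)) (begin
        length F + stars (cycles λ′)                                    ≡⟨ cong (_+_ (length F)) (stars-↭ᶜ t) ⟨
        length F + stars (markedCycles m (perm p))                      ≡⟨ stars-replicate (length F) (markedCycles m (perm p)) ⟨
        stars (replicate (length F) (∗ ∷ []) ++ markedCycles m (perm p)) ≡⟨ stars-↭ᶜ extended ⟨
        stars (markedCycles m σ)                                        ≡⟨ stars-markedCycles σ m≤n ⟩
        n ∸ m                                                           ∎) ⟩
      n ∸ m ∸ stars (cycles λ′)                                       ≡⟨ ℕ.∸-+-assoc n m (stars (cycles λ′)) ⟩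
      n ∸ size λ′                                                     ∎

  -- Here the type of p is still unknown, so F is measured by cycles (∗) instead of stars: neither p
  -- nor `λ′` has any. Equal numbers of cycles (∗) can then be cancelled.
  restriction-type : (λ′ : Shape m) → Proper λ′ → (∀ {x} → x ∈ domain p → m ≤ x → perm p · x ≢ x) →
                     HasType σ (λ′ ^ (n ∸ size λ′)) → HasType (perm p) λ′
  restriction-type λ′ λ-proper moves t = replicate-cancel (length F)
    (subst (λ k → replicate (length F) (∗ ∷ []) ++ markedCycles m (perm p) ↭ᶜ replicate k (∗ ∷ []) ++ cycles λ′)
           (sym |F|≡) same)
    where
    open ≡-Reasoning
    k = n ∸ size λ′

    same : replicate (length F) (∗ ∷ []) ++ markedCycles m (perm p) ↭ᶜ replicate k (∗ ∷ []) ++ cycles λ′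
    same = ↭ᶜ-trans (↭ᶜ-sym extended) t

    |F|≡ : length F ≡ k
    |F|≡ = begin
      length F                                        ≡⟨ ℕ.+-identityʳ (length F) ⟨
      length F + 0                                    ≡⟨ cong (_+_ (length F)) (moves⇒starCycles≡0 (perm p) p! moves) ⟨
      length F + starCycles (markedCycles m (perm p)) ≡⟨ starCycles-replicate (length F) (markedCycles m (perm p)) ⟨
      starCycles (replicate (length F) (∗ ∷ []) ++ markedCycles m (perm p)) ≡⟨ starCycles-↭ᶜ same ⟩
      starCycles (replicate k (∗ ∷ []) ++ cycles λ′)  ≡⟨ starCycles-replicate k (cycles λ′) ⟩
      k + starCycles (cycles λ′)                      ≡⟨ cong (_+_ k) λ-proper ⟩
      k + 0                                           ≡⟨ ℕ.+-identityʳ k ⟩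
      k                                               ∎

restrict : ∀ {m n} → m ≤ n → Sym (upTo n) → PartialPerm m
restrict {m} {n} m≤n σ = record
  { domain     = filter relevant? (upTo n)
  ; increasing = AllPairs.filter⁺ relevant? (AllPairs.applyUpTo⁺₁ id n λ i<j _ → i<j)
  ; marked     = All.tabulate λ i∈ → ∈-filter⁺ relevant? (∈-upTo⁺ (ℕ.<-≤-trans (∈-upTo⁻ i∈) m≤n)) (inj₁ (∈-upTo⁻ i∈))
  ; perm       = record { extension = extension σ ; fixesRest = λ {x} → fixes x (x ∈? upTo n) (σ · x ≟ x) }
  }
  where
  relevant? : ∀ x → Dec (x < m ⊎ σ · x ≢ x)
  relevant? x = (x <? m) ⊎-dec ¬? (σ · x ≟ x)

  fixes : ∀ x → Dec (x ∈ upTo n) → Dec (σ · x ≡ x) → x ∉ filter relevant? (upTo n) → σ · x ≡ x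
  fixes x _         (yes σx≡x) _  = σx≡x
  fixes x (no x∉n)  (no _)     _  = fixesRest σ x∉n
  fixes x (yes x∈n) (no σx≢x)  x∉ = contradiction (∈-filter⁺ relevant? x∈n (inj₂ σx≢x)) x∉

∈-restrict⁻ : ∀ {m n x} (m≤n : m ≤ n) (σ : Sym (upTo n)) → x ∈ domain (restrict m≤n σ) →
              x ∈ upTo n × (x < m ⊎ σ · x ≢ x)
∈-restrict⁻ {m} m≤n σ x∈ = ∈-filter⁻ (λ x → (x <? m) ⊎-dec ¬? (σ · x ≟ x)) {xs = upTo _} x∈

moves⇒∈domain : ∀ {m x} (p : PartialPerm m) → perm p · x ≢ x → x ∈ domain p
moves⇒∈domain {x = x} p px≢x with x ∈? domain p
... | yes x∈ = x∈
... | no  x∉ = contradiction (fixesRest (perm p) x∉) px≢x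

restrict-type : ∀ {m n} (m≤n : m ≤ n) (σ : Sym (upTo n)) (λ′ : Shape m) → Proper λ′ →
                HasType σ (λ′ ^ (n ∸ size λ′)) → HasType (perm (restrict m≤n σ)) λ′
restrict-type m≤n σ λ′ λ-proper = restriction-type σ (restrict m≤n σ) m≤n (proj₁ ∘ ∈-restrict⁻ m≤n σ) (λ _ → refl) λ′ λ-proper
  λ x∈ m≤x → [ (λ x<m → contradiction m≤x (ℕ.<⇒≱ x<m)) , id ]′ (proj₂ (∈-restrict⁻ m≤n σ x∈))

-- A partial permutation of proper type is determined by its extension: its
-- domain is [m] together with the points that it moves.
proper-domain : ∀ {m} (p q : PartialPerm m) (λ′ : Shape m) → Proper λ′ → HasType (perm p) λ′ →
                (∀ x → perm p · x ≡ perm q · x) → ∀ {x} → x ∈ domain p → x ∈ domain q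
proper-domain {m} p q λ′ λ-proper t p≗q {x} x∈ with x <? m
... | yes x<m = All.lookup (marked q) (∈-upTo⁺ x<m)
... | no  x≮m = moves⇒∈domain q (subst (_≢ x) (p≗q x)
      (starCycles≡0⇒moves (perm p) (increasing⇒Unique (increasing p)) (trans (starCycles-↭ᶜ t) λ-proper) x∈ (ℕ.≮⇒≥ x≮m)))

proper-≗ₚ : ∀ {m} (p q : PartialPerm m) (λ′ : Shape m) → Proper λ′ → HasType (perm p) λ′ → HasType (perm q) λ′ →
            (∀ x → perm p · x ≡ perm q · x) → p ≗ₚ q
proper-≗ₚ p q λ′ λ-proper tp tq p≗q =
  increasing-≡ (increasing p) (increasing q) (proper-domain p q λ′ λ-proper tp p≗q)
    (proper-domain q p λ′ λ-proper tq (sym ∘ p≗q)) ,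
  p≗q

map-++-fixes : ∀ {f : ℕ → ℕ} xs {us vs} → map f (xs ++ us) ≡ xs ++ vs → ∀ {x} → x ∈ xs → f x ≡ x
map-++-fixes (x ∷ xs) eq (here refl) = List.∷-injectiveˡ eq
map-++-fixes (x ∷ xs) eq (there x∈)  = map-++-fixes xs (List.∷-injectiveʳ eq) x∈

-- Counting factorisations

length-concatMap : ∀ {X Y : Set} (f : X → List Y) xs → length (concatMap f xs) ≡ sum (map (length ∘ f) xs)
length-concatMap f []       = refl
length-concatMap f (x ∷ xs) = trans (List.length-++ (f x)) (cong (_+_ (length (f x))) (length-concatMap f xs))

segment : ℕ → ℕ → List ℕ
segment r j = applyUpTo (_+_ r) j

segment-increasing : ∀ r j → AllPairs _<_ (segment r j)
segment-increasing r j = AllPairs.applyUpTo⁺₁ (_+_ r) j λ i<i′ _ → ℕ.+-monoʳ-< r i<i′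

segment-≥ : ∀ r j → All (r ≤_) (segment r j)
segment-≥ r j = All.applyUpTo⁺₂ (_+_ r) j λ i → ℕ.m≤m+n r i

∈-segment⁺ : ∀ {r n x} → r ≤ x → x < n → x ∈ segment r (n ∸ r)
∈-segment⁺ {r} r≤x x<n = subst (_∈ _) (ℕ.m+[n∸m]≡n r≤x) (∈-applyUpTo⁺ (_+_ r) (ℕ.∸-monoˡ-< x<n r≤x))

∈-segment⁻ : ∀ {r n x} → r ≤ n → x ∈ segment r (n ∸ r) → x < n
∈-segment⁻ {r} {n} r≤n x∈ with i , i< , refl ← ∈-applyUpTo⁻ (_+_ r) x∈ =
  subst (r + i <_) (ℕ.m+[n∸m]≡n r≤n) (ℕ.+-monoʳ-< r i<)

-- The model permutation of type ρ on various domains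

module _ {m} (ρ : Shape m) where
  private
    r = size ρ

  model : Sym (upTo r)
  model = proj₁ (realise ρ)

  modelOn : ∀ S → AllPairs _<_ S → All (r ≤_) S → PartialPerm m
  modelOn S S< r≤S = record
    { domain     = upTo r ++ S
    ; increasing = AllPairs.++⁺ (AllPairs.applyUpTo⁺₁ id r λ i<j _ → i<j) S<
                     (All.tabulate λ x∈ → All.map (ℕ.<-≤-trans (∈-upTo⁻ x∈)) r≤S)
    ; marked     = All.tabulate λ i∈ → ∈-++⁺ˡ (∈-upTo⁺ (ℕ.<-≤-trans (∈-upTo⁻ i∈) (ℕ.m≤m+n m _)))
    ; perm       = widen ∈-++⁺ˡ model
    }

  modelWithin : ∀ {n} → r ≤ n → Sym (upTo n)
  modelWithin r≤n = widen (λ x∈ → ∈-upTo⁺ (ℕ.<-≤-trans (∈-upTo⁻ x∈) r≤n)) model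

  widen-model-type : ∀ {d S} (ω : Sym d) → (∀ x → model · x ≡ ω · x) → Unique d → Unique S → All (r ≤_) S →
                     (∀ {x} → x ∈ S ++ upTo r → x ∈ d) → (∀ {x} → x ∈ d → x ∈ S ++ upTo r) →
                     HasType ω (ρ ^ length S)
  widen-model-type {S = S} ω eq d! S! r≤S to from = ↭ᶜ-trans
    (markedCycles-extend model ω (Unique.upTo⁺ r) d! S! eq (All.map (ℕ.≤-trans (ℕ.m≤m+n m _)) r≤S)
      (λ x∈S x∈r → ℕ.<⇒≱ (∈-upTo⁻ x∈r) (All.lookup r≤S x∈S)) to from)
    (↭ₛ.++⁺ˡ (rotationSetoid _) (replicate (length S) (∗ ∷ [])) (proj₂ (realise ρ)))

  modelOn-type : ∀ S S< r≤S → HasType (perm (modelOn S S< r≤S)) (ρ ^ length S)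
  modelOn-type S S< r≤S = widen-model-type (perm (modelOn S S< r≤S)) (λ _ → refl)
    (increasing⇒Unique (increasing (modelOn S S< r≤S))) (increasing⇒Unique S<) r≤S
    (∈-resp-↭ (++-comm S (upTo r))) (∈-resp-↭ (++-comm (upTo r) S))

  modelWithin-type : ∀ {n} (r≤n : r ≤ n) → HasType (modelWithin r≤n) (ρ ^ (n ∸ r))
  modelWithin-type {n} r≤n = subst (λ j → HasType (modelWithin r≤n) (ρ ^ j)) (List.length-applyUpTo (_+_ r) (n ∸ r))
    (widen-model-type (modelWithin r≤n) (λ _ → refl) (Unique.upTo⁺ n)
      (increasing⇒Unique (segment-increasing r (n ∸ r))) (segment-≥ r (n ∸ r))
      (λ x∈ → ∈-upTo⁺ ([ ∈-segment⁻ r≤n , (λ x∈r → ℕ.<-≤-trans (∈-upTo⁻ x∈r) r≤n) ]′ (∈-++⁻ (segment r (n ∸ r)) x∈)))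
      (λ {x} x∈ → [ (λ x<r → ∈-++⁺ʳ (segment r (n ∸ r)) (∈-upTo⁺ x<r))
                  , (λ r≤x → ∈-++⁺ˡ (∈-segment⁺ r≤x (∈-upTo⁻ x∈))) ]′ (ℕ.<-≤-connex x r)))

  model-moves : Proper ρ → ∀ {x} → x < r → m ≤ x → model · x ≢ x
  model-moves ρ-proper x<r = starCycles≡0⇒moves model (Unique.upTo⁺ r)
    (trans (starCycles-↭ᶜ (proj₂ (realise ρ))) ρ-proper) (∈-upTo⁺ x<r)

  standard : ℕ → PartialPerm m
  standard j = modelOn (segment r j) (segment-increasing r j) (segment-≥ r j)

  standard-type : ∀ j → HasType (perm (standard j)) (ρ ^ j)
  standard-type j = subst (λ i → HasType (perm (standard j)) (ρ ^ i)) (List.length-applyUpTo (_+_ r) j)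
    (modelOn-type (segment r j) (segment-increasing r j) (segment-≥ r j))

  -- The two domains are matched entry by entry and share the prefix `upTo r`, so `π` fixes that
  -- prefix pointwise. It therefore commutes with the model, which moves nothing outside the prefix.
  modelOn-conjugate : ∀ S S< r≤S → Σ[ π ∈ ℕ ↔ ℕ ] (∀ {i} → i < m → Inverse.to π i ≡ i) ×
                      Conjugates π (modelOn S S< r≤S) (standard (length S))
  modelOn-conjugate S S< r≤S = π , (λ i<m → fixes (ℕ.<-≤-trans i<m (ℕ.m≤m+n m _))) , record
      { image    = λ {y} y∈ → subst (to y ∈_) eq (∈-map⁺ to y∈)
      ; preimage = λ {y} y∈ → let z , z∈ , y≡ = ∈-map⁻ to (subst (y ∈_) (sym eq) y∈)
                              in subst (_∈ upTo r ++ S) (sym (trans (cong from y≡) (strictlyInverseʳ z))) z∈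
      ; commutes = λ y → commute y (ℕ.<-≤-connex y r)
      }
    where
    lengths : length (upTo r ++ S) ≡ length (upTo r ++ segment r (length S))
    lengths = trans (List.length-++ (upTo r)) (trans
      (cong (_+_ (length (upTo r))) (sym (List.length-applyUpTo (_+_ r) (length S)))) (sym (List.length-++ (upTo r))))

    matched : Σ[ π ∈ ℕ ↔ ℕ ] map (Inverse.to π) (upTo r ++ S) ≡ upTo r ++ segment r (length S)
    matched = matching (increasing⇒Unique (increasing (modelOn S S< r≤S)))
                       (increasing⇒Unique (increasing (standard (length S)))) lengths

    π  = proj₁ matched
    eq = proj₂ matched
    open Inverse π using (to; from; strictlyInverseʳ)

    fixes : ∀ {x} → x < r → to x ≡ x
    fixes x<r = map-++-fixes (upTo r) eq (∈-upTo⁺ x<r)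

    fixesAbove : ∀ {x} → r ≤ x → model · x ≡ x
    fixesAbove r≤x = fixesRest model λ x∈ → ℕ.<⇒≱ (∈-upTo⁻ x∈) r≤x

    commute : ∀ y → y < r ⊎ r ≤ y → model · to y ≡ to (model · y)
    commute y (inj₁ y<r) = trans (cong (model ·_) (fixes y<r))
                                 (sym (fixes (∈-upTo⁻ (·-closed model (∈-upTo⁺ y<r)))))
    commute y (inj₂ r≤y) = trans
      (fixesAbove (ℕ.≮⇒≥ λ πy<r → ℕ.<⇒≱ πy<r (subst (r ≤_) (sym (↔-injective π (fixes πy<r))) r≤y)))
      (cong to (sym (fixesAbove r≤y)))

module _ {m : ℕ} (λ′ δ ρ : Shape m) where
  private
    r = size ρ

  -- The natural number behind the coefficient of `ρ ^ j`; neither n nor the coefficient ring enters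
  -- it.
  standardCount : ℕ → ℕ
  standardCount j = length (factorisations λ′ δ (standard ρ j))

  modelOn-count : ∀ S S< r≤S → length (factorisations λ′ δ (modelOn ρ S S< r≤S)) ≡ standardCount (length S)
  modelOn-count S S< r≤S = let π , fixes , c = modelOn-conjugate ρ S S< r≤S in
    factorisations-conjugate {x = modelOn ρ S S< r≤S} {standard ρ (length S)} λ′ δ fixes c

  module _ {n : ℕ} (λ-proper : Proper λ′) (δ-proper : Proper δ) (ρ-proper : Proper ρ) (m≤n : m ≤ n) (r≤n : r ≤ n) where
    private
      ω  = modelWithin ρ r≤n
      F  = segment r (n ∸ r)
      F< = segment-increasing r (n ∸ r)
      λₙ = λ′ ^ (n ∸ size λ′)
      δₙ = δ ^ (n ∸ size δ)

      Subset : Set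
      Subset = ∃ λ e → e ⊆ F × AllPairs _<_ e

      onSubset : Subset → PartialPerm m
      onSubset (e , e⊆F , e<) = modelOn ρ e e< (All-resp-⊆ e⊆F (segment-≥ r (n ∸ r)))

      local : List (PartialPerm m × PartialPerm m)
      local = concatMap (factorisations λ′ δ ∘ onSubset) (subsets F F<)

      onSubset⊆ : ∀ s {x} → x ∈ domain (onSubset s) → x ∈ upTo n
      onSubset⊆ (e , e⊆F , _) x∈ = ∈-upTo⁺ ([ (λ x∈r → ℕ.<-≤-trans (∈-upTo⁻ x∈r) r≤n)
                                            , (λ x∈e → ∈-segment⁻ r≤n (Sublist.lookup e⊆F x∈e)) ]′ (∈-++⁻ (upTo r) x∈))

      -- The domain of a product is `upTo r` followed by the chosen subset, so a pair of factors
      -- cannot occur for two different subsets.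
      domain-determined : ∀ s s′ {f f′} → f ∈ factorisations λ′ δ (onSubset s) →
                          f′ ∈ factorisations λ′ δ (onSubset s′) → _≈ₚₚ_ λ′ δ f f′ → proj₁ s ≡ proj₁ s′
      domain-determined s s′ {p , q} {p′ , q′} f∈ f′∈ (p≈ , q≈) = List.++-cancelˡ (upTo r) _ _
        (trans (sym (proj₁ (IsProduct⇒≈ₚ p′ q′ (onSubset s)
                 (IsProduct-resp {p = p} {p′} {q} {q′} {onSubset s}
                   (≈ₚ⇒≗ₚ {p = p} {p′} p≈) (≈ₚ⇒≗ₚ {p = q} {q′} q≈)
                   (proj₁ (factorisations-sound λ′ δ {onSubset s} f∈))))))
               (proj₁ (IsProduct⇒≈ₚ p′ q′ (onSubset s′) (proj₁ (factorisations-sound λ′ δ {onSubset s′} f′∈)))))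

      local-unique : AllPairs (λ f f′ → ¬ _≈ₚₚ_ λ′ δ f f′) local
      local-unique = AllPairs.concat⁺
        (All.map⁺ (All.tabulate λ {s} _ → factorisations-unique λ′ δ (onSubset s)))
        (AllPairs.map⁺ (AllPairs.map (λ {s} {s′} e≢e′ → All.tabulate λ f∈ → All.tabulate λ f′∈ f≈f′ →
          e≢e′ (domain-determined s s′ f∈ f′∈ f≈f′)) (subsets-unique F F<)))

      -- The types are kept because the extensions alone do not determine a partial permutation;
      -- together with a proper type they do.
      record Corresponds (f : Sym (upTo n) × Sym (upTo n)) (f′ : PartialPerm m × PartialPerm m) : Set where
        field
          ≗₁    : ∀ x → proj₁ f · x ≡ perm (proj₁ f′) · x
          ≗₂    : ∀ x → proj₂ f · x ≡ perm (proj₂ f′) · x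
          type₁ : HasType (perm (proj₁ f′)) λ′
          type₂ : HasType (perm (proj₂ f′)) δ
      open Corresponds

      toLocal : ∀ {f} → f ∈ groupFactorisations λₙ δₙ ω → ∃ λ f′ → f′ ∈ local × Corresponds f f′
      toLocal {σ , τ} f∈ =
        let prod , tσ , tτ = groupFactorisations-sound λₙ δₙ {ω} f∈
            s , s∈ , s≡    = subsets-complete (subset⇒⊆ S< F< (λ x∈ → proj₁ (∈-filter⁻ inD? {xs = F} x∈))) F<
            tp = restrict-type m≤n σ λ′ λ-proper tσ
            tq = restrict-type m≤n τ δ δ-proper tτ
            (p′ , q′) , f′∈ , p≗ , q≗ = factorisations-complete λ′ δ {onSubset s} {p , q} (product s s≡ prod , tp , tq)
        in (p′ , q′) , ∈-concatMap⁺ _ (Any.map (λ { refl → f′∈ }) s∈) , record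
          { ≗₁    = proj₂ p≗
          ; ≗₂    = proj₂ q≗
          ; type₁ = ≗ₚ-type p p′ λ′ p≗ tp
          ; type₂ = ≗ₚ-type q q′ δ q≗ tq
          }
        where
        p = restrict m≤n σ
        q = restrict m≤n τ

        inD? : ∀ x → Dec (x ∈ domain p ⊎ x ∈ domain q)
        inD? x = (x ∈? domain p) ⊎-dec (x ∈? domain q)

        S  = filter inD? F
        S< : AllPairs _<_ S
        S< = AllPairs.filter⁺ inD? F<

        product : ∀ s → proj₁ s ≡ S → (∀ x → σ · (τ · x) ≡ ω · x) → IsProduct p q (onSubset s)
        product (_ , _ , _) refl prod = record
          { left⊆   = λ y∈ → inside (proj₁ (∈-restrict⁻ m≤n σ y∈)) (inj₁ y∈)
          ; right⊆  = λ y∈ → inside (proj₁ (∈-restrict⁻ m≤n τ y∈)) (inj₂ y∈)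
          ; covered = λ y∈ → [ (λ y∈r → coveredBelow (∈-upTo⁻ y∈r)) , (λ y∈S → proj₂ (∈-filter⁻ inD? {xs = F} y∈S)) ]′
                               (∈-++⁻ (upTo r) y∈)
          ; values  = prod
          }
          where
          inside : ∀ {y} → y ∈ upTo n → y ∈ domain p ⊎ y ∈ domain q → y ∈ upTo r ++ S
          inside {y} y∈n y∈D = [ (λ y<r → ∈-++⁺ˡ (∈-upTo⁺ y<r))
                               , (λ r≤y → ∈-++⁺ʳ (upTo r) (∈-filter⁺ inD? (∈-segment⁺ r≤y (∈-upTo⁻ y∈n)) y∈D))
                               ]′ (ℕ.<-≤-connex y r)

          -- For y in [m] both domains contain y. Otherwise ω moves y because ρ is proper; if `τ`
          -- fixes y, then `σ` sends y to `ω · y` and so moves it.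
          coveredBelow : ∀ {y} → y < r → y ∈ domain p ⊎ y ∈ domain q
          coveredBelow {y} y<r with ℕ.<-≤-connex y m | τ · y ≟ y
          ... | inj₁ y<m | _        = inj₁ (All.lookup (marked p) (∈-upTo⁺ y<m))
          ... | inj₂ m≤y | no τy≢y  = inj₂ (moves⇒∈domain q τy≢y)
          ... | inj₂ m≤y | yes τy≡y = inj₁ (moves⇒∈domain p λ σy≡y →
                  model-moves ρ ρ-proper y<r m≤y (trans (sym (prod y)) (trans (cong (σ ·_) τy≡y) σy≡y)))

      fromLocal : ∀ {f′} → f′ ∈ local → ∃ λ f → f ∈ groupFactorisations λₙ δₙ ω × Corresponds f f′
      fromLocal {p , q} f′∈ =
        let s , _ , f′∈s   = find (∈-concatMap⁻ (factorisations λ′ δ ∘ onSubset) {xs = subsets F F<} f′∈)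
            prod , tp , tq = factorisations-sound λ′ δ {onSubset s} f′∈s
            σ = widen (λ x∈ → onSubset⊆ s (left⊆ prod x∈)) (perm p)
            τ = widen (λ x∈ → onSubset⊆ s (right⊆ prod x∈)) (perm q)
            f , f∈ , σ≗ , τ≗ = groupFactorisations-complete λₙ δₙ {ω} {σ , τ}
              ( values prod
              , completion-type σ p m≤n (λ x∈ → onSubset⊆ s (left⊆ prod x∈)) (λ _ → refl) λ′ tp
              , completion-type τ q m≤n (λ x∈ → onSubset⊆ s (right⊆ prod x∈)) (λ _ → refl) δ tq)
        in f , f∈ , record { ≗₁ = sym ∘ σ≗ ; ≗₂ = sym ∘ τ≗ ; type₁ = tp ; type₂ = tq }

    -- The correspondence is injective in both directions: permutations of [n] are determined by
    -- their extensions, and the partial factors are so because λ and δ are proper.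
    groupFactorisations-count : length (groupFactorisations λₙ δₙ ω) ≡
                                sum (map (standardCount ∘ length ∘ proj₁) (subsets F F<))
    groupFactorisations-count = trans
      (ℕ.≤-antisym
        (count-≤ {_≈_ = _≈ₛₛ_ λₙ δₙ} Corresponds
          (λ {(σ , τ)} {(σ′ , τ′)} c c′ → ≗⇒≈ₛ σ σ′ (λ x → trans (≗₁ c x) (sym (≗₁ c′ x))) ,
                                          ≗⇒≈ₛ τ τ′ (λ x → trans (≗₂ c x) (sym (≗₂ c′ x))))
          (groupFactorisations-unique λₙ δₙ ω) toLocal)
        (count-≤ {_≈_ = _≈ₚₚ_ λ′ δ} (λ f′ f → Corresponds f f′)
          (λ {(p , q)} {(p′ , q′)} c c′ →
            ≗ₚ⇒≈ₚ {p = p} {p′} (proper-≗ₚ p p′ λ′ λ-proper (type₁ c) (type₁ c′) λ x → trans (sym (≗₁ c x)) (≗₁ c′ x)) ,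
            ≗ₚ⇒≈ₚ {p = q} {q′} (proper-≗ₚ q q′ δ δ-proper (type₂ c) (type₂ c′) λ x → trans (sym (≗₂ c x)) (≗₂ c′ x)))
          local-unique fromLocal))
      (trans (length-concatMap (factorisations λ′ δ ∘ onSubset) (subsets F F<))
        (cong sum (List.map-cong (λ (e , e⊆F , e<) → modelOn-count e e< (All-resp-⊆ e⊆F (segment-≥ r (n ∸ r))))
                                 (subsets F F<))))

-- Comparison of the two families of structure coefficients

theorem0p8 : ∀ {r ℓ} (R : CommutativeRing r ℓ) (m : ℕ) (λ′ δ ρ : Shape m) → Proper λ′ → Proper δ → Proper ρ →
    (k : PartialPermCoefficients R m) →
    Σ[ kℤ ∈ (ℕ → ℤ) ]
    (∀ j → CommutativeRing._≈_ R (coeff k λ′ δ (ρ ^ j)) (fromℤ R (kℤ j))) ×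
    (∀ n → m ≤ n → (λ≤n : size λ′ ≤ n) (δ≤n : size δ ≤ n) (ρ≤n : size ρ ≤ n)
    (c : CentraliserCoefficients n m) →
    coeff c (complete λ′ n λ≤n) (complete δ n δ≤n) (complete ρ n ρ≤n) ≡
    sumOver +-*-commutativeRing (upTo (suc (n ∸ size ρ)))
    (λ j → kℤ j * + ((n ∸ size ρ) C j)))
theorem0p8 R m λ′ δ ρ λ-proper δ-proper ρ-proper k = (λ j → + κ j) , k-value , c-value
  where
  κ : ℕ → ℕ
  κ = standardCount λ′ δ ρ

  k-value : ∀ j → CommutativeRing._≈_ R (coeff k λ′ δ (ρ ^ j)) (fromℤ R (+ κ j))
  k-value j = CommutativeRing.trans R
    -- The coefficient is read off at `standard ρ j`, a partial permutation of type `ρ ^ j`.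
    (coeff-value R {I = shapeSetoid m} (λ τ p → hasType? (perm p) τ) k
      (λ t t′ → ↭ᶜ-trans (↭ᶜ-sym t) t′) (λ eq t → ↭ᶜ-trans t eq) λ′ δ {ρ ^ j} {standard ρ j} (standard-type ρ j))
    (convolution-indicator R _∙ₚ_ _≈ₚ?_ partialPermsWithin
      (λ p → hasType? (perm p) λ′) (λ q → hasType? (perm q) δ) (standard ρ j))

  c-value : ∀ n → m ≤ n → (λ≤n : size λ′ ≤ n) (δ≤n : size δ ≤ n) (ρ≤n : size ρ ≤ n) (c : CentraliserCoefficients n m) →
            coeff c (complete λ′ n λ≤n) (complete δ n δ≤n) (complete ρ n ρ≤n) ≡
            sumOver +-*-commutativeRing (upTo (suc (n ∸ size ρ))) (λ j → + κ j * + ((n ∸ size ρ) C j))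
  c-value n m≤n λ≤n δ≤n ρ≤n c = begin
    coeff c (complete λ′ n λ≤n) (complete δ n δ≤n) (complete ρ n ρ≤n)
      ≡⟨ coeff-value +-*-commutativeRing {I = shapeOfSizeSetoid m n} (λ (τ , _) σ → hasType? σ τ) c
           (λ t t′ → ↭ᶜ-trans (↭ᶜ-sym t) t′) (λ eq t → ↭ᶜ-trans t eq)
           (complete λ′ n λ≤n) (complete δ n δ≤n) {complete ρ n ρ≤n} {ω} (modelWithin-type ρ ρ≤n) ⟩
    groupRingProduct n (K (complete λ′ n λ≤n)) (K (complete δ n δ≤n)) ω
      ≡⟨ convolution-indicator +-*-commutativeRing _∘ₛ_ _≈ₛ?_ (λ _ → permutations (upTo n))
           (λ σ → hasType? σ (λ′ ^ (n ∸ size λ′))) (λ τ → hasType? τ (δ ^ (n ∸ size δ))) ω ⟩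
    fromℤ +-*-commutativeRing (+ length (groupFactorisations (λ′ ^ (n ∸ size λ′)) (δ ^ (n ∸ size δ)) ω))
      ≡⟨ fromℤ-ℤ _ ⟩
    + length (groupFactorisations (λ′ ^ (n ∸ size λ′)) (δ ^ (n ∸ size δ)) ω)
      ≡⟨ cong +_ (groupFactorisations-count λ′ δ ρ λ-proper δ-proper ρ-proper m≤n ρ≤n) ⟩
    + sum (map (κ ∘ length ∘ proj₁) (subsets F F<))
      -- The bound `suc M` is the least one exceeding the number M of free points, and makes j run
      -- through 0, ..., M.
      ≡⟨ cong +_ (binomialSum≡subsetSum κ F F< (suc M) (ℕ.≤-reflexive (cong suc |F|≡M))) ⟨
    + sum (applyUpTo (λ j → κ j ℕ.* (length F C j)) (suc M))
      ≡⟨ cong (λ l → + sum (applyUpTo (λ j → κ j ℕ.* (l C j)) (suc M))) |F|≡M ⟩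
    + sum (applyUpTo (λ j → κ j ℕ.* (M C j)) (suc M))
      ≡⟨ cong (λ js → + sum js) (List.map-upTo (λ j → κ j ℕ.* (M C j)) (suc M)) ⟨
    + sum (map (λ j → κ j ℕ.* (M C j)) (upTo (suc M)))
      ≡⟨ sumOver-ℤ κ (M C_) (upTo (suc M)) ⟨
    sumOver +-*-commutativeRing (upTo (suc M)) (λ j → + κ j * + (M C j)) ∎
    where
    open ≡-Reasoning
    M  = n ∸ size ρ
    ω  = modelWithin ρ ρ≤n
    F  = segment (size ρ) M
    F< = segment-increasing (size ρ) M
    |F|≡M : length F ≡ M
    |F|≡M = List.length-applyUpTo (_+_ (size ρ)) M
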